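{- The irreducible polynomials over the tropical hyperfield $\mathbb T$ are precisely the polynomials of degree $1$, and the set of polynomials over $\mathbb T$ has the unique factorization property.
   Context: The tropical hyperfield $\mathbb T$ is the set $\mathbb R_{\ge0}$ with usual multiplication and hyperaddition $a\boxplus b=\{\max\{a,b\}\}$ if $a\ne b$ and $a\boxplus a=[0,a]$; equivalently $c\in a\boxplus b$ iff the maximum of $a,b,c$ is attained at least twice. Here $-a=a$. Iterated sums: $\boxplus_{i=1}^n a_i=\bigcup_{b\in\boxplus_{i=1}^{n-1}a_i} b\boxplus a_n$. A polynomial over $\mathbb T$ is a finitely supported sequence $(c_i)$ in $\mathbb T$, written $\sum c_iT^i$, with degree the largest $k$ with $c_k\ne0$. Hyperproduct: $p\boxdot q=\{\sum e_iT^i : e_i\in \boxplus_{k+l=i} c_kd_l\}$ for $p=\sum c_iT^i,q=\sum d_iT^i$, and $\boxdot_{i=1}^n q_i=\bigcup_{r\in\boxdot_{i=1}^{n-1}q_i} r\boxdot q_n$. $p\sim q$ means $p\in a\boxdot q$ for some $a\neq0$. $p$ is irreducible if $\deg p\ge1$ and $p\in q_1\boxdot q_2$ implies $p\sim q_1$ or $p\sim q_2$. The unique factorization property: whenever $p\in q_1\boxdot\cdots\boxdot q_n$ and $p\in q'_1\boxdot\cdots\boxdot q'_m$ with all factors irreducible, then $n=m$ and $q_i\sim q'_{\sigma(i)}$ for some permutation $\sigma$. -}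

module Defs where

open import Data.Empty using (⊥)
open import Data.Fin using (Fin; fromℕ; inject₁)
open import Data.Fin.Permutation using (Permutation; _⟨$⟩ʳ_)
open import Data.Nat as ℕ using (ℕ; zero; suc; _∸_)
open import Data.Product using (Σ-syntax; ∃-syntax; _×_; _,_)
open import Data.Rational as ℚ using (ℚ; 0ℚ; 1ℚ)
import Data.Rational.Properties as ℚ
open import Data.Sum using (_⊎_; inj₁; inj₂)
open import Level using (Lift; 0ℓ) renaming (suc to lsuc)
open import Relation.Binary.Definitions using (tri<; tri≈; tri>)
open import Relation.Binary.PropositionalEquality using (_≡_; refl; subst)
open import Relation.Nullary using (¬_; contradiction)

------------------------------------------------------------------------
-- Nonnegative real numbers

-- Dedekind's construction: x is given by its lower cut { q ∈ ℚ | 0 < q < x }.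
-- Zero is the empty cut.  An upper bound has to be required to be positive,
-- because nonpositive rationals never belong to the cut.

record ℝ≥0 : Set₁ where
  field
    below    : ℚ → Set
    positive : ∀ {q} → below q → 0ℚ ℚ.< q
    lower    : ∀ {p q} → 0ℚ ℚ.< p → p ℚ.< q → below q → below p
    rounded  : ∀ {p} → below p → ∃[ q ] p ℚ.< q × below q
    bounded  : ∃[ q ] 0ℚ ℚ.< q × ¬ below q

open ℝ≥0 public

infix 4 _≤_ _≈_ _≉_

_≤_ : ℝ≥0 → ℝ≥0 → Set
x ≤ y = ∀ q → below x q → below y q

_≈_ : ℝ≥0 → ℝ≥0 → Set
x ≈ y = x ≤ y × y ≤ x

_≉_ : ℝ≥0 → ℝ≥0 → Set
x ≉ y = ¬ x ≈ y

<⇒≱ : ∀ {p q} → p ℚ.< q → ¬ q ℚ.≤ p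
<⇒≱ p<q q≤p = ℚ.<-irrefl refl (ℚ.<-≤-trans p<q q≤p)

below-bound : ∀ x {p q} → below x p → 0ℚ ℚ.< q → ¬ below x q → p ℚ.< q
below-bound x {p} {q} p∈x 0<q q∉x with ℚ.<-cmp p q
... | tri< p<q _ _ = p<q
... | tri≈ _ p≡q _ = contradiction (subst (below x) p≡q p∈x) q∉x
... | tri> _ _ q<p = contradiction (lower x 0<q q<p p∈x) q∉x

0# : ℝ≥0
0# = record
  { below    = λ _ → ⊥
  ; positive = λ ()
  ; lower    = λ _ _ ()
  ; rounded  = λ ()
  ; bounded  = 1ℚ , ℚ.positive⁻¹ 1ℚ , λ ()
  }

infixl 6 _⊔_

_⊔_ : ℝ≥0 → ℝ≥0 → ℝ≥0
x ⊔ y = record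
  { below    = λ q → below x q ⊎ below y q
  ; positive = λ { (inj₁ q∈x) → positive x q∈x
                 ; (inj₂ q∈y) → positive y q∈y }
  ; lower    = λ { 0<p p<q (inj₁ q∈x) → inj₁ (lower x 0<p p<q q∈x)
                 ; 0<p p<q (inj₂ q∈y) → inj₂ (lower y 0<p p<q q∈y) }
  ; rounded  = λ { (inj₁ p∈x) → let q , p<q , q∈x = rounded x p∈x in q , p<q , inj₁ q∈x
                 ; (inj₂ p∈y) → let q , p<q , q∈y = rounded y p∈y in q , p<q , inj₂ q∈y }
  ; bounded  =
      let r , 0<r , r∉x = bounded x
          s , 0<s , s∉y = bounded y
      in r ℚ.⊔ s
       , ℚ.<-≤-trans 0<r (ℚ.p≤p⊔q r s)
       , λ { (inj₁ m∈x) → <⇒≱ (below-bound x m∈x 0<r r∉x) (ℚ.p≤p⊔q r s)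
           ; (inj₂ m∈y) → <⇒≱ (below-bound y m∈y 0<s s∉y) (ℚ.p≤q⊔p r s) }
  }

private
  *-monoʳ-< : ∀ {b a a′} → 0ℚ ℚ.< b → a ℚ.< a′ → a ℚ.* b ℚ.< a′ ℚ.* b
  *-monoʳ-< {b} 0<b = ℚ.*-monoˡ-<-pos b {{ℚ.positive 0<b}}

  *-monoˡ-< : ∀ {b a a′} → 0ℚ ℚ.< b → a ℚ.< a′ → b ℚ.* a ℚ.< b ℚ.* a′
  *-monoˡ-< {b} 0<b = ℚ.*-monoʳ-<-pos b {{ℚ.positive 0<b}}

  *-pos : ∀ {a b} → 0ℚ ℚ.< a → 0ℚ ℚ.< b → 0ℚ ℚ.< a ℚ.* b
  *-pos {a} {b} 0<a 0<b = subst (ℚ._< a ℚ.* b) (ℚ.*-zeroˡ b) (*-monoʳ-< 0<b 0<a)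

infixl 7 _·_

_·_ : ℝ≥0 → ℝ≥0 → ℝ≥0
x · y = record
  { below    = λ q → 0ℚ ℚ.< q × (∃[ a ] ∃[ b ] below x a × below y b × q ℚ.≤ a ℚ.* b)
  ; positive = λ (0<q , _) → 0<q
  ; lower    = λ 0<p p<q (_ , a , b , a∈x , b∈y , q≤ab) →
      0<p , a , b , a∈x , b∈y , ℚ.≤-trans (ℚ.<⇒≤ p<q) q≤ab
  ; rounded  = λ (0<p , a , b , a∈x , b∈y , p≤ab) →
      let a′ , a<a′ , a′∈x = rounded x a∈x
          p<a′b = ℚ.≤-<-trans p≤ab (*-monoʳ-< (positive y b∈y) a<a′)
      in a′ ℚ.* b , p<a′b , ℚ.<-trans 0<p p<a′b , a′ , b , a′∈x , b∈y , ℚ.≤-refl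
  ; bounded  =
      let r , 0<r , r∉x = bounded x
          s , 0<s , s∉y = bounded y
      in r ℚ.* s
       , *-pos 0<r 0<s
       , λ (_ , a , b , a∈x , b∈y , rs≤ab) →
           <⇒≱ (ℚ.<-trans (*-monoʳ-< (positive y b∈y) (below-bound x a∈x 0<r r∉x))
                            (*-monoˡ-< 0<r (below-bound y b∈y 0<s s∉y)))
                 rs≤ab
  }

------------------------------------------------------------------------
-- The tropical hyperfield: ℝ≥0 with multiplication _·_ and the following
-- multivalued addition.  Multivalued operations are written as membership
-- relations.

𝕋 : Set₁
𝕋 = ℝ≥0

infix 4 _∈_⊞_ _∈⊞[_]_

_∈_⊞_ : 𝕋 → 𝕋 → 𝕋 → Set
c ∈ a ⊞ b = (a ≉ b × c ≈ a ⊔ b) ⊎ (a ≈ b × c ≤ a)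

-- x ∈⊞[ n ] a  means  x ∈ a 0 ⊞ a 1 ⊞ ⋯ ⊞ a n  (n + 1 summands).
_∈⊞[_]_ : 𝕋 → ℕ → (ℕ → 𝕋) → Set₁
x ∈⊞[ zero  ] a = Lift (lsuc 0ℓ) (x ≈ a 0)
x ∈⊞[ suc n ] a = ∃[ b ] b ∈⊞[ n ] a × x ∈ b ⊞ a (suc n)

------------------------------------------------------------------------
-- Polynomials

record Poly : Set₁ where
  field
    coeff          : ℕ → 𝕋
    finite-support : ∃[ n ] ∀ i → n ℕ.≤ i → coeff i ≈ 0#

open Poly public

infix 4 _≈ₚ_ _∈_⊡_ _∈⊡_ _∼_

_≈ₚ_ : Poly → Poly → Set
p ≈ₚ q = ∀ i → coeff p i ≈ coeff q i

HasDegree : Poly → ℕ → Set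
HasDegree p k = coeff p k ≉ 0# × (∀ i → k ℕ.< i → coeff p i ≈ 0#)

const : 𝕋 → Poly
const a = record
  { coeff          = λ { zero → a ; (suc _) → 0# }
  ; finite-support = 1 , λ { (suc _) _ → (λ _ z → z) , (λ _ z → z) }
  }

_∈_⊡_ : Poly → Poly → Poly → Set₁
p ∈ q ⊡ r = ∀ i → coeff p i ∈⊞[ i ] (λ k → coeff q k · coeff r (i ∸ k))

-- p ∈⊡ q  means  p ∈ q₀ ⊡ ⋯ ⊡ qₙ, bracketed to the left (n + 1 ≥ 1 factors).
_∈⊡_ : ∀ {n} → Poly → (Fin (suc n) → Poly) → Set₁
_∈⊡_ {zero}  p q = Lift (lsuc 0ℓ) (p ≈ₚ q Fin.zero)
_∈⊡_ {suc n} p q = ∃[ r ] r ∈⊡ (λ i → q (inject₁ i)) × p ∈ r ⊡ q (fromℕ (suc n))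

_∼_ : Poly → Poly → Set₁
p ∼ q = ∃[ a ] a ≉ 0# × p ∈ const a ⊡ q

Irreducible : Poly → Set₁
Irreducible p =
  (∃[ k ] 1 ℕ.≤ k × HasDegree p k) ×
  (∀ q₁ q₂ → p ∈ q₁ ⊡ q₂ → p ∼ q₁ ⊎ p ∼ q₂)

UniqueFactorization : Set₁
UniqueFactorization =
  ∀ {n m} (p : Poly) (q : Fin (suc n) → Poly) (q′ : Fin (suc m) → Poly) →
  (∀ i → Irreducible (q i)) → (∀ j → Irreducible (q′ j)) →
  p ∈⊡ q → p ∈⊡ q′ →
  suc n ≡ suc m ×
  (Σ[ σ ∈ Permutation (suc n) (suc m) ] ∀ i → q i ∼ q′ (σ ⟨$⟩ʳ i))

{-# OPTIONS --safe #-}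

-- Fix a point x.  Among the indices i at which pᵢxⁱ is maximal, consider the first and the last
-- one.  Both are additive under ⊡: if they are h for q and k for r, then q_h · r_k strictly
-- dominates the other terms of the hypersum of index h + k, which is therefore single-valued.
-- The difference of the last and the first index is thus additive as well, and for a linear
-- polynomial it is 1 or 0 according to whether or not x is its root.  Hence a product determines
-- how many of its linear factors have a given root.  Measuring monomials by the trivial
-- valuation instead, the same argument gives the degree and the order of vanishing at 0.
--
-- A polynomial p of degree n + 1 with p₀ ≠ 0 lies in (1 + yT) ⊡ r where rᵢ = pᵢ ⊔ y · rᵢ₋₁ for
-- i ≤ n, provided that y · rₙ = pₙ₊₁; such a y exists by an intermediate value argument.

module Submission where

open import Defs
open import Algebra.Bundles using (CommutativeMonoid)
open import Axiom.ExcludedMiddle using (ExcludedMiddle)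
open import Data.Empty using (⊥-elim)
open import Data.Fin.Base as Fin using (Fin; inject₁; fromℕ; punchIn)
open import Data.Fin.Permutation using (Permutation; _⟨$⟩ʳ_; insert; insert-punchIn) renaming (id to id↔)
open import Data.Integer as ℤ using (ℤ)
import Data.Integer.Properties as ℤ
open import Data.Nat as ℕ using (ℕ; zero; suc; _∸_)
import Data.Nat.Properties as ℕ
open import Data.Product using (Σ-syntax; ∃-syntax; _×_; _,_; proj₁; proj₂)
open import Data.Rational as ℚ using (ℚ; 0ℚ; 1ℚ; ½)
import Data.Rational.Properties as ℚ
open import Data.Rational.Solver using (module +-*-Solver)
import Data.Rational.Unnormalised as ℚᵘ
import Data.Rational.Unnormalised.Properties as ℚᵘ
open import Data.Sum using (_⊎_; inj₁; inj₂)
open import Function.Base using (_∘_)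
open import Function.Bundles using (_⇔_; mk⇔)
open import Level using (Lift; 0ℓ; lift) renaming (suc to lsuc)
open import Relation.Binary.Definitions using (tri<; tri≈; tri>)
open import Relation.Binary.PropositionalEquality
  using (_≡_; _≢_; refl; sym; trans; cong; subst; subst₂; module ≡-Reasoning)
import Relation.Binary.Reasoning.Base.Triple as Triple
open import Relation.Binary.Structures using (IsPreorder)
open import Relation.Nullary using (¬_; Dec; yes; no; contradiction)
open import Relation.Nullary.Decidable using (map′)
open import Algebra.Properties.CommutativeMonoid.Sum ℕ.+-0-commutativeMonoid
  using (sum-remove; ∑-distrib-+)
open import Algebra.Properties.Monoid.Sum ℕ.+-0-monoid using (sum; sum-init-last)

-- Rational arithmetic

*-pos : ∀ {a b} → 0ℚ ℚ.< a → 0ℚ ℚ.< b → 0ℚ ℚ.< a ℚ.* b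
*-pos {a} {b} 0<a 0<b =
  ℚ.positive⁻¹ (a ℚ.* b) {{ℚ.pos*pos⇒pos a {{ℚ.positive 0<a}} b {{ℚ.positive 0<b}}}}

*-monoʳ-≤ : ∀ {r p q} → 0ℚ ℚ.< r → p ℚ.≤ q → r ℚ.* p ℚ.≤ r ℚ.* q
*-monoʳ-≤ {r} 0<r = ℚ.*-monoˡ-≤-nonNeg r {{ℚ.pos⇒nonNeg r {{ℚ.positive 0<r}}}}

*-monoʳ-< : ∀ {r p q} → 0ℚ ℚ.< r → p ℚ.< q → r ℚ.* p ℚ.< r ℚ.* q
*-monoʳ-< {r} 0<r = ℚ.*-monoʳ-<-pos r {{ℚ.positive 0<r}}

*-monoˡ-≤ : ∀ {r p q} → 0ℚ ℚ.< r → p ℚ.≤ q → p ℚ.* r ℚ.≤ q ℚ.* r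
*-monoˡ-≤ {r} 0<r = ℚ.*-monoʳ-≤-nonNeg r {{ℚ.pos⇒nonNeg r {{ℚ.positive 0<r}}}}

*-monoˡ-< : ∀ {r p q} → 0ℚ ℚ.< r → p ℚ.< q → p ℚ.* r ℚ.< q ℚ.* r
*-monoˡ-< {r} 0<r = ℚ.*-monoˡ-<-pos r {{ℚ.positive 0<r}}

*-mono-< : ∀ {a b a′ b′} → 0ℚ ℚ.< a′ → 0ℚ ℚ.< b → a ℚ.< a′ → b ℚ.< b′ → a ℚ.* b ℚ.< a′ ℚ.* b′
*-mono-< 0<a′ 0<b a<a′ b<b′ = ℚ.<-trans (*-monoˡ-< 0<b a<a′) (*-monoʳ-< 0<a′ b<b′)

p*q<q : ∀ {p q} → 0ℚ ℚ.< q → p ℚ.< 1ℚ → p ℚ.* q ℚ.< q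
p*q<q {p} {q} 0<q p<1 = subst (p ℚ.* q ℚ.<_) (ℚ.*-identityˡ q) (*-monoˡ-< 0<q p<1)

quotient : ∀ {a b} → 0ℚ ℚ.< a → 0ℚ ℚ.< b → ∃[ c ] 0ℚ ℚ.< c × c ℚ.* b ≡ a
quotient {a} {b} 0<a 0<b = a ℚ.* ℚ.1/ b , *-pos 0<a (ℚ.positive⁻¹ (ℚ.1/ b) {{ℚ.1/pos⇒pos b}}) , (begin
  a ℚ.* ℚ.1/ b ℚ.* b    ≡⟨ ℚ.*-assoc a (ℚ.1/ b) b ⟩
  a ℚ.* (ℚ.1/ b ℚ.* b)  ≡⟨ cong (a ℚ.*_) (ℚ.*-inverseˡ b) ⟩
  a ℚ.* 1ℚ              ≡⟨ ℚ.*-identityʳ a ⟩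
  a                     ∎)
  where
  open ≡-Reasoning
  instance
    _ = ℚ.positive 0<b
    _ = ℚ.pos⇒nonZero b

quotient-< : ∀ {a b} → 0ℚ ℚ.< a → a ℚ.< b → ∃[ c ] 0ℚ ℚ.< c × c ℚ.< 1ℚ × c ℚ.* b ≡ a
quotient-< {a} {b} 0<a a<b =
  let c , 0<c , cb≡a = quotient 0<a 0<b
  in c , 0<c , ℚ.*-cancelʳ-<-nonNeg b {{ℚ.pos⇒nonNeg b {{ℚ.positive 0<b}}}}
                 (subst₂ ℚ._<_ (sym cb≡a) (sym (ℚ.*-identityˡ b)) a<b) , cb≡a
  where 0<b = ℚ.<-trans 0<a a<b

-- μ = (1 + κ) / 2
square-between : ∀ {κ} → 0ℚ ℚ.< κ → κ ℚ.< 1ℚ →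
                 ∃[ μ ] 0ℚ ℚ.< μ × μ ℚ.< 1ℚ × κ ℚ.≤ μ ℚ.* μ
square-between {κ} 0<κ κ<1 = μ , ℚ.<-trans 0<κ κ<μ , μ<1 , κ≤μ²
  where
  open +-*-Solver
  μ δ : ℚ
  μ = κ ℚ.+ δ
  δ = ½ ℚ.* (1ℚ ℚ.- κ)
  0<1-κ : 0ℚ ℚ.< 1ℚ ℚ.- κ
  0<1-κ = subst (ℚ._< 1ℚ ℚ.- κ) (ℚ.+-inverseʳ κ) (ℚ.+-monoˡ-< (ℚ.- κ) κ<1)
  0<δ : 0ℚ ℚ.< δ
  0<δ = *-pos (ℚ.positive⁻¹ ½) 0<1-κ
  κ<μ : κ ℚ.< μ
  κ<μ = subst (ℚ._< μ) (ℚ.+-identityʳ κ) (ℚ.+-monoʳ-< κ 0<δ)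
  μ<1 : μ ℚ.< 1ℚ
  μ<1 = subst₂ ℚ._<_ (ℚ.+-identityʳ μ)
    (solve 1 (λ k → (k :+ con ½ :* (con 1ℚ :- k)) :+ con ½ :* (con 1ℚ :- k) := con 1ℚ) refl κ)
    (ℚ.+-monoʳ-< μ 0<δ)
  -- AM-GM for `1` and `κ`: the square of their mean exceeds their product by exactly δ².
  κ≤μ² : κ ℚ.≤ μ ℚ.* μ
  κ≤μ² = subst₂ ℚ._≤_ (ℚ.+-identityʳ κ)
    (solve 1 (λ k → k :+ (con ½ :* (con 1ℚ :- k)) :* (con ½ :* (con 1ℚ :- k))
                  := (k :+ con ½ :* (con 1ℚ :- k)) :* (k :+ con ½ :* (con 1ℚ :- k))) refl κ)
    (ℚ.+-monoʳ-≤ κ (ℚ.<⇒≤ (*-pos 0<δ 0<δ)))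

natural : ℕ → ℚ
natural zero    = 0ℚ
natural (suc n) = 1ℚ ℚ.+ natural n

-- Addition in `ℚ` normalises fractions, so `natural n` does not compute for a variable `n`; the
-- unnormalised fraction n/1 can be compared with numerators directly.
toℚᵘ-natural : ∀ n → ℚ.toℚᵘ (natural n) ℚᵘ.≃ ℚᵘ.mkℚᵘ (ℤ.+ n) 0
toℚᵘ-natural zero    = ℚᵘ.≃-refl
toℚᵘ-natural (suc n) = ℚᵘ.≃-trans (ℚ.toℚᵘ-homo-+ 1ℚ (natural n))
  (ℚᵘ.≃-trans (ℚᵘ.+-congʳ ℚᵘ.1ℚᵘ (toℚᵘ-natural n))
    (ℚᵘ.*≡* (cong (λ m → (ℤ.1ℤ ℤ.+ m) ℤ.* ℤ.1ℤ) (ℤ.*-identityʳ (ℤ.+ n)))))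

p≤natural : ∀ p → ∃[ n ] p ℚ.≤ natural n
p≤natural p@(ℚ.mkℚ k d _) = ℤ.∣ k ∣ , ℚ.toℚᵘ-cancel-≤
  (ℚᵘ.≤-trans (ℚᵘ.*≤* k*1≤∣k∣*d) (ℚᵘ.≤-reflexive (ℚᵘ.≃-sym (toℚᵘ-natural ℤ.∣ k ∣))))
  where
  open ℤ.≤-Reasoning
  i≤∣i∣ : ∀ i → i ℤ.≤ ℤ.+ ℤ.∣ i ∣
  i≤∣i∣ (ℤ.+ n)      = ℤ.≤-refl
  i≤∣i∣ ℤ.-[1+ n ]   = ℤ.-≤+
  k*1≤∣k∣*d : k ℤ.* ℤ.1ℤ ℤ.≤ ℤ.+ ℤ.∣ k ∣ ℤ.* ℤ.+ suc d
  k*1≤∣k∣*d = begin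
    k ℤ.* ℤ.1ℤ                 ≡⟨ ℤ.*-identityʳ k ⟩
    k                          ≤⟨ i≤∣i∣ k ⟩
    ℤ.+ ℤ.∣ k ∣                ≤⟨ ℤ.+≤+ (ℕ.m≤m*n ℤ.∣ k ∣ (suc d)) ⟩
    ℤ.+ (ℤ.∣ k ∣ ℕ.* suc d)    ≡⟨ ℤ.pos-* ℤ.∣ k ∣ (suc d) ⟩
    ℤ.+ ℤ.∣ k ∣ ℤ.* ℤ.+ suc d  ∎

-- The step is asked for only from `s₀` on: it will come from enlarging `s` by a constant factor,
-- which gains a fixed `ε` only where `s` stays away from 0.
archimedean : ∀ {ε s₀ : ℚ} (P : ℚ → Set) → 0ℚ ℚ.< ε → P s₀ →
              (∀ {s} → s₀ ℚ.≤ s → P s → P (s ℚ.+ ε)) → ∀ C → ∃[ s ] C ℚ.≤ s × P s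
archimedean {ε} {s₀} P 0<ε P₀ step C = s n , C≤sₙ , proj₂ (Pₙ n)
  where
  open +-*-Solver
  s : ℕ → ℚ
  s zero    = s₀
  s (suc n) = s n ℚ.+ ε
  Pₙ : ∀ n → s₀ ℚ.≤ s n × P (s n)
  Pₙ zero    = ℚ.≤-refl , P₀
  Pₙ (suc n) = let s₀≤sₙ , p = Pₙ n in
    ℚ.≤-trans s₀≤sₙ (subst (ℚ._≤ s (suc n)) (ℚ.+-identityʳ (s n)) (ℚ.+-monoʳ-≤ (s n) (ℚ.<⇒≤ 0<ε))) ,
    step s₀≤sₙ p
  s≡ : ∀ n → s n ≡ s₀ ℚ.+ natural n ℚ.* ε
  s≡ zero    = solve 2 (λ a e → a := a :+ con 0ℚ :* e) refl s₀ ε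
  s≡ (suc n) = trans (cong (ℚ._+ ε) (s≡ n))
    (solve 3 (λ a m e → a :+ m :* e :+ e := a :+ (con 1ℚ :+ m) :* e) refl s₀ (natural n) ε)
  -- `e` is 1/ε, so `x` is the rational number of steps of length `ε` from `s₀` to `C`, and `n` is a
  -- natural number above it.
  i = quotient (ℚ.positive⁻¹ 1ℚ) 0<ε
  e = proj₁ i
  x = (C ℚ.- s₀) ℚ.* e
  n = proj₁ (p≤natural x)
  s₀+xε≡C : s₀ ℚ.+ x ℚ.* ε ≡ C
  s₀+xε≡C = trans (solve 4 (λ a c e ε → a :+ ((c :- a) :* e) :* ε := a :+ (c :- a) :* (e :* ε)) refl s₀ C e ε)
    (trans (cong (λ z → s₀ ℚ.+ (C ℚ.- s₀) ℚ.* z) (proj₂ (proj₂ i)))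
      (solve 2 (λ a c → a :+ (c :- a) :* con 1ℚ := c) refl s₀ C))
  C≤sₙ : C ℚ.≤ s n
  C≤sₙ = subst₂ ℚ._≤_ s₀+xε≡C (sym (s≡ n)) (ℚ.+-monoʳ-≤ s₀ (*-monoˡ-≤ 0<ε (proj₂ (p≤natural x))))

-- Order and multiplication of nonnegative reals

≤-refl : ∀ {x} → x ≤ x
≤-refl _ q∈x = q∈x

≤-trans : ∀ {x y z} → x ≤ y → y ≤ z → x ≤ z
≤-trans x≤y y≤z q q∈x = y≤z q (x≤y q q∈x)

≈-refl : ∀ {x} → x ≈ x
≈-refl {x} = ≤-refl {x} , ≤-refl {x}

≈-sym : ∀ {x y} → x ≈ y → y ≈ x
≈-sym (x≤y , y≤x) = y≤x , x≤y

≈-trans : ∀ {x y z} → x ≈ y → y ≈ z → x ≈ z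
≈-trans {x} {y} {z} (x≤y , y≤x) (y≤z , z≤y) =
  ≤-trans {x} {y} {z} x≤y y≤z , ≤-trans {z} {y} {x} z≤y y≤x

0≤ : ∀ x → 0# ≤ x
0≤ x _ ()

≤0⇒≈0 : ∀ {x} → x ≤ 0# → x ≈ 0#
≤0⇒≈0 {x} x≤0 = x≤0 , 0≤ x

≉0-resp-≤ : ∀ {x y} → x ≤ y → x ≉ 0# → y ≉ 0#
≉0-resp-≤ {x} {y} x≤y x≉0 (y≤0 , _) = x≉0 (≤0⇒≈0 {x} (≤-trans {x} {y} {0#} x≤y y≤0))

∈⇒≉0 : ∀ {x q} → below x q → x ≉ 0#
∈⇒≉0 q∈x (x≤0 , _) = x≤0 _ q∈x

x≤x⊔y : ∀ x y → x ≤ x ⊔ y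
x≤x⊔y _ _ _ = inj₁

y≤x⊔y : ∀ x y → y ≤ x ⊔ y
y≤x⊔y _ _ _ = inj₂

⊔-lub : ∀ {x y z} → x ≤ z → y ≤ z → x ⊔ y ≤ z
⊔-lub x≤z y≤z q (inj₁ q∈x) = x≤z q q∈x
⊔-lub x≤z y≤z q (inj₂ q∈y) = y≤z q q∈y

lower-≤ : ∀ x {p q} → 0ℚ ℚ.< p → p ℚ.≤ q → below x q → below x p
lower-≤ x {p} {q} 0<p p≤q q∈x with ℚ.<-cmp p q
... | (tri< p<q _ _) = lower x 0<p p<q q∈x
... | (tri≈ _ p≡q _) = subst (below x) (sym p≡q) q∈x
... | (tri> _ _ q<p) = contradiction p≤q (<⇒≱ q<p)

⊔-∈ : ∀ x {p q} → below x p → below x q → below x (p ℚ.⊔ q)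
⊔-∈ x {p} {q} p∈x q∈x with ℚ.≤-total p q
... | inj₁ p≤q = subst (below x) (sym (ℚ.p≤q⇒p⊔q≡q p≤q)) q∈x
... | inj₂ q≤p = subst (below x) (sym (ℚ.p≥q⇒p⊔q≡p q≤p)) p∈x

·-∈ : ∀ x y {a b} → below x a → below y b → below (x · y) (a ℚ.* b)
·-∈ x y {a} {b} a∈x b∈y = *-pos (positive x a∈x) (positive y b∈y) , a , b , a∈x , b∈y , ℚ.≤-refl

·-mono : ∀ {x x′ y y′} → x ≤ x′ → y ≤ y′ → x · y ≤ x′ · y′
·-mono x≤x′ y≤y′ q (0<q , a , b , a∈x , b∈y , q≤ab) = 0<q , a , b , x≤x′ a a∈x , y≤y′ b b∈y , q≤ab

·-cong : ∀ {x x′ y y′} → x ≈ x′ → y ≈ y′ → x · y ≈ x′ · y′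
·-cong {x} {x′} {y} {y′} (x≤x′ , x′≤x) (y≤y′ , y′≤y) =
  ·-mono {x} {x′} {y} {y′} x≤x′ y≤y′ , ·-mono {x′} {x} {y′} {y} x′≤x y′≤y

·-congˡ : ∀ x {y y′} → y ≈ y′ → x · y ≈ x · y′
·-congˡ x {y} {y′} = ·-cong {x} {x} {y} {y′} (≈-refl {x})

·-comm-≤ : ∀ x y → x · y ≤ y · x
·-comm-≤ x y q (0<q , a , b , a∈x , b∈y , q≤ab) =
  0<q , b , a , b∈y , a∈x , subst (q ℚ.≤_) (ℚ.*-comm a b) q≤ab

·-comm : ∀ x y → x · y ≈ y · x
·-comm x y = ·-comm-≤ x y , ·-comm-≤ y x

·-assoc-≤ : ∀ x y z → (x · y) · z ≤ x · (y · z)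
·-assoc-≤ x y z q (0<q , d , c , (_ , a , b , a∈x , b∈y , d≤ab) , c∈z , q≤dc) =
  0<q , a , b ℚ.* c , a∈x , ·-∈ y z b∈y c∈z ,
  ℚ.≤-trans q≤dc (ℚ.≤-trans (*-monoˡ-≤ (positive z c∈z) d≤ab) (ℚ.≤-reflexive (ℚ.*-assoc a b c)))

·-assoc : ∀ x y z → (x · y) · z ≈ x · (y · z)
·-assoc x y z = ·-assoc-≤ x y z , assoc-≥
  where
  -- The reverse inclusion is the one already proved, for `z`, `y`, `x`, conjugated by
  -- commutativity.
  assoc-≥ : x · (y · z) ≤ (x · y) · z
  assoc-≥ =
    ≤-trans {x · (y · z)} {(y · z) · x} {(x · y) · z} (·-comm-≤ x (y · z))
   (≤-trans {(y · z) · x} {(z · y) · x} {(x · y) · z} (·-mono {y · z} {z · y} {x} {x} (·-comm-≤ y z) (≤-refl {x}))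
   (≤-trans {(z · y) · x} {z · (y · x)} {(x · y) · z} (·-assoc-≤ z y x)
   (≤-trans {z · (y · x)} {(y · x) · z} {(x · y) · z} (·-comm-≤ z (y · x))
    (·-mono {y · x} {x · y} {z} {z} (·-comm-≤ y x) (≤-refl {z})))))

-- The real number max(s, 0): the cut is empty for nonpositive `s`, which is why the bound is raised
-- to at least 1.
rational : ℚ → ℝ≥0
rational s = record
  { below    = λ q → 0ℚ ℚ.< q × q ℚ.< s
  ; positive = proj₁
  ; lower    = λ { 0<p p<q (_ , q<s) → 0<p , ℚ.<-trans p<q q<s }
  ; rounded  = λ { (0<p , p<s) → let q , p<q , q<s = ℚ.<-dense p<s in q , p<q , ℚ.<-trans 0<p p<q , q<s }
  ; bounded  = 1ℚ ℚ.⊔ s , ℚ.<-≤-trans (ℚ.positive⁻¹ 1ℚ) (ℚ.p≤p⊔q 1ℚ s) ,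
               λ { (_ , 1⊔s<s) → <⇒≱ 1⊔s<s (ℚ.p≤q⊔p 1ℚ s) }
  }

rational-mono : ∀ {s t} → s ℚ.≤ t → rational s ≤ rational t
rational-mono s≤t q (0<q , q<s) = 0<q , ℚ.<-≤-trans q<s s≤t

rational-≤ : ∀ x {s} → below x s → rational s ≤ x
rational-≤ x s∈x q (0<q , q<s) = lower x 0<q q<s s∈x

1# : ℝ≥0
1# = rational 1ℚ

1≉0 : 1# ≉ 0#
1≉0 = ∈⇒≉0 {1#} (ℚ.positive⁻¹ ½ , ℚ.toℚᵘ-cancel-< (ℚᵘ.*<* (ℤ.+<+ ℕ.≤-refl)))

·-identityˡ : ∀ x → 1# · x ≈ x
·-identityˡ x = to , from
  where
  to : 1# · x ≤ x
  to q (0<q , a , b , (_ , a<1) , b∈x , q≤ab) =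
    lower x 0<q (ℚ.≤-<-trans q≤ab (p*q<q (positive x b∈x) a<1)) b∈x
  from : x ≤ 1# · x
  from q q∈x =
    -- Roundedness leaves room to write q = (q / q′) q′ with a first factor strictly below 1.
    let q′ , q<q′ , q′∈x = rounded x q∈x
        c , 0<c , c<1 , cq′≡q = quotient-< (positive x q∈x) q<q′
    in positive x q∈x , c , q′ , (0<c , c<1) , q′∈x , ℚ.≤-reflexive (sym cq′≡q)

·-identityʳ : ∀ x → x · 1# ≈ x
·-identityʳ x = ≈-trans {x · 1#} {1# · x} {x} (·-comm x 1#) (·-identityˡ x)

·-1-commutativeMonoid : CommutativeMonoid (lsuc 0ℓ) 0ℓ
·-1-commutativeMonoid = record
  { Carrier = ℝ≥0
  ; _≈_ = _≈_
  ; _∙_ = _·_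
  ; ε = 1#
  ; isCommutativeMonoid = record
    { isMonoid = record
      { isSemigroup = record
        { isMagma = record
          { isEquivalence = record
            { refl  = λ {x} → ≈-refl {x}
            ; sym   = λ {x} {y} → ≈-sym {x} {y}
            ; trans = λ {x} {y} {z} → ≈-trans {x} {y} {z}
            }
          ; ∙-cong = λ {x} {y} {u} {v} → ·-cong {x} {y} {u} {v} }
        ; assoc = ·-assoc }
      ; identity = ·-identityˡ , ·-identityʳ }
    ; comm = ·-comm }
  }

≤-isPreorder : IsPreorder _≈_ _≤_
≤-isPreorder = record
  { isEquivalence = CommutativeMonoid.isEquivalence ·-1-commutativeMonoid
  ; reflexive     = proj₁
  ; trans         = λ {x} {y} {z} → ≤-trans {x} {y} {z}
  }

·-zeroˡ : ∀ {x} y → x ≈ 0# → x · y ≈ 0#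
·-zeroˡ {x} y (x≤0 , _) = ≤0⇒≈0 {x · y} λ { _ (_ , a , _ , a∈x , _) → x≤0 a a∈x }

·-zeroʳ : ∀ x {y} → y ≈ 0# → x · y ≈ 0#
·-zeroʳ x {y} (y≤0 , _) = ≤0⇒≈0 {x · y} λ { _ (_ , _ , b , _ , b∈y , _) → y≤0 b b∈y }

open import Algebra.Properties.CommutativeSemigroup
  (CommutativeMonoid.commutativeSemigroup ·-1-commutativeMonoid)
  using (interchange; x∙yz≈y∙xz)
open import Algebra.Properties.Monoid.Mult (CommutativeMonoid.monoid ·-1-commutativeMonoid)
  using (×-homo-+) renaming (_×_ to _×ᵐ_)

infix 4 _<_

-- Failure of the reverse inequality. That it implies `_≤_` amounts to totality of the order and
-- waits for excluded middle.
record _<_ (x y : ℝ≥0) : Set where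
  constructor ≰⇒<
  field <⇒≰ : ¬ y ≤ x

open _<_

<⇒≉0 : ∀ {x y} → x < y → y ≉ 0#
<⇒≉0 {x} {y} x<y (y≤0 , _) = <⇒≰ x<y (≤-trans {y} {0#} {x} y≤0 (0≤ x))

≈0<≉0 : ∀ {x y} → x ≈ 0# → y ≉ 0# → x < y
≈0<≉0 {x} {y} (x≤0 , _) y≉0 = ≰⇒< λ y≤x → y≉0 (≤0⇒≈0 {y} (≤-trans {y} {x} {0#} y≤x x≤0))

<-≤-trans : ∀ {x y z} → x < y → y ≤ z → x < z
<-≤-trans {x} {y} {z} x<y y≤z = ≰⇒< λ z≤x → <⇒≰ x<y (≤-trans {y} {z} {x} y≤z z≤x)

≤-<-trans : ∀ {x y z} → x ≤ y → y < z → x < z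
≤-<-trans {x} {y} {z} x≤y y<z = ≰⇒< λ z≤x → <⇒≰ y<z (≤-trans {z} {x} {y} z≤x x≤y)

-- Solving y · horner c y n ≈ d for y

-- The maximum over k ≤ i of c(k) times y to the power i - k, in Horner form. These values are the
-- coefficients sought for the cofactor of 1 + yT.
horner : (ℕ → ℝ≥0) → ℝ≥0 → ℕ → ℝ≥0
horner c y zero    = c 0
horner c y (suc i) = c (suc i) ⊔ y · horner c y i

module _ (c : ℕ → ℝ≥0) where

  private
    h : ℝ≥0 → ℕ → ℝ≥0
    h = horner c
    y·h : ℝ≥0 → ℕ → ℝ≥0
    y·h y i = y · h y i
    hℚ y·hℚ : ℚ → ℕ → ℝ≥0
    hℚ s = h (rational s)
    y·hℚ s = y·h (rational s)

  horner-mono   : ∀ {x y} → x ≤ y → ∀ i → h x i ≤ h y i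
  y·horner-mono : ∀ {x y} → x ≤ y → ∀ i → y·h x i ≤ y·h y i

  horner-mono x≤y zero    q q∈       = q∈
  horner-mono x≤y (suc i) q (inj₁ q∈) = inj₁ q∈
  horner-mono {x} {y} x≤y (suc i) q (inj₂ q∈) = inj₂ (y·horner-mono {x} {y} x≤y i q q∈)

  y·horner-mono {x} {y} x≤y i = ·-mono {x} {y} {h x i} {h y i} x≤y (horner-mono {x} {y} x≤y i)

  -- Membership of `u` rests on finitely many members of the cut `y`, and their maximum is a
  -- sufficient `s`. The given member `a` supplies `s` where the value does not involve `y`.
  horner-leftContinuous : ∀ y i {a u} → below y a → below (h y i) u →
                          ∃[ s ] below y s × below (hℚ s i) u
  y·horner-leftContinuous : ∀ y i {u} → below (y·h y i) u →
                            ∃[ s ] below y s × below (y·hℚ s i) u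

  horner-leftContinuous y zero    {a} a∈y u∈       = a , a∈y , u∈
  horner-leftContinuous y (suc i) {a} a∈y (inj₁ u∈) = a , a∈y , inj₁ u∈
  horner-leftContinuous y (suc i)     a∈y (inj₂ u∈) =
    let s , s∈y , u∈′ = y·horner-leftContinuous y i u∈ in s , s∈y , inj₂ u∈′

  y·horner-leftContinuous y i (0<u , a , b , a∈y , b∈h , u≤ab) =
    let t , t∈y , b∈hₜ = horner-leftContinuous y i a∈y b∈h
        s , a<s , s∈y = rounded y a∈y
    -- `s` exceeds `a` strictly, so that `a` lies in its cut; `t` keeps `b` below the Horner value.
    in s ℚ.⊔ t , ⊔-∈ y s∈y t∈y , 0<u , a , b ,
       (positive y a∈y , ℚ.<-≤-trans a<s (ℚ.p≤p⊔q s t)) ,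
       horner-mono {rational t} {rational (s ℚ.⊔ t)} (rational-mono (ℚ.p≤q⊔p s t)) i b b∈hₜ , u≤ab

  -- Continuity from the right in s, uniformly in s.
  horner-shrink : ∀ i {κ} → 0ℚ ℚ.< κ → κ ℚ.< 1ℚ → ∃[ μ ] 0ℚ ℚ.< μ × μ ℚ.< 1ℚ ×
                  (∀ s w → below (hℚ s i) w → below (hℚ (μ ℚ.* s) i) (κ ℚ.* w))
  y·horner-shrink : ∀ i {κ} → 0ℚ ℚ.< κ → κ ℚ.< 1ℚ → ∃[ μ ] 0ℚ ℚ.< μ × μ ℚ.< 1ℚ ×
                    (∀ s w → below (y·hℚ s i) w → below (y·hℚ (μ ℚ.* s) i) (κ ℚ.* w))

  horner-shrink zero {κ} 0<κ κ<1 = κ , 0<κ , κ<1 , λ s w w∈ →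
    let 0<w = positive (c 0) w∈ in lower (c 0) (*-pos 0<κ 0<w) (p*q<q 0<w κ<1) w∈
  horner-shrink (suc i) {κ} 0<κ κ<1 =
    let μ , 0<μ , μ<1 , shrink = y·horner-shrink i 0<κ κ<1
    in μ , 0<μ , μ<1 , λ
      { s w (inj₁ w∈) → let 0<w = positive (c (suc i)) w∈ in
          inj₁ (lower (c (suc i)) (*-pos 0<κ 0<w) (p*q<q 0<w κ<1) w∈)
      ; s w (inj₂ w∈) → inj₂ (shrink s w w∈) }

  y·horner-shrink i {κ} 0<κ κ<1 =
    -- The loss is shared by the two factors of the product: each may shrink by `κ′`, and κ ≤ κ′².
    -- Taking the larger of `κ′` and `ν` as `μ` serves both.
    let κ′ , 0<κ′ , κ′<1 , κ≤κ′² = square-between 0<κ κ<1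
        ν , 0<ν , ν<1 , shrink = horner-shrink i 0<κ′ κ′<1
        μ = κ′ ℚ.⊔ ν
        0<μ = ℚ.<-≤-trans 0<κ′ (ℚ.p≤p⊔q κ′ ν)
        μ<1 = ⊔-<1 κ′ ν κ′<1 ν<1
    in μ , 0<μ , μ<1 , λ { s w (0<w , a , b , (0<a , a<s) , b∈ , w≤ab) →
      let 0<b = positive (hℚ s i) b∈
          0<s = ℚ.<-trans 0<a a<s
          νs≤μs = *-monoˡ-≤ 0<s (ℚ.p≤q⊔p κ′ ν)
          κ′a<μs = ℚ.<-≤-trans (*-monoʳ-< 0<κ′ a<s) (*-monoˡ-≤ 0<s (ℚ.p≤p⊔q κ′ ν))
      in *-pos 0<κ 0<w , κ′ ℚ.* a , κ′ ℚ.* b , (*-pos 0<κ′ 0<a , κ′a<μs) ,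
         horner-mono {rational (ν ℚ.* s)} {rational (μ ℚ.* s)} (rational-mono νs≤μs) i _ (shrink s b b∈) ,
         ℚ.≤-trans (*-monoʳ-≤ 0<κ w≤ab)
           (ℚ.≤-trans (*-monoˡ-≤ (*-pos 0<a 0<b) κ≤κ′²) (ℚ.≤-reflexive (rearrange κ′ a b))) }
    where
    open +-*-Solver
    rearrange : ∀ k a b → k ℚ.* k ℚ.* (a ℚ.* b) ≡ k ℚ.* a ℚ.* (k ℚ.* b)
    rearrange = solve 3 (λ k a b → k :* k :* (a :* b) := k :* a :* (k :* b)) refl
    ⊔-<1 : ∀ a b → a ℚ.< 1ℚ → b ℚ.< 1ℚ → a ℚ.⊔ b ℚ.< 1ℚ
    ⊔-<1 a b a<1 b<1 with ℚ.⊔-sel a b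
    ... | inj₁ ≡a = subst (ℚ._< 1ℚ) (sym ≡a) a<1
    ... | inj₂ ≡b = subst (ℚ._< 1ℚ) (sym ≡b) b<1

  -- For s > 1 the contribution of `c 0` only grows with the index. Hence s times the Horner value
  -- outgrows any `d`, which bounds the set `S` below.
  c₀≤horner : ∀ {s t} → 1ℚ ℚ.< s → below (c 0) t → ∀ i → below (hℚ s i) t
  c₀≤horner 1<s t∈c₀ zero    = t∈c₀
  c₀≤horner {s} {t} 1<s t∈c₀ (suc i) =
    inj₂ (positive (c 0) t∈c₀ , 1ℚ , t , (ℚ.positive⁻¹ 1ℚ , 1<s) , c₀≤horner 1<s t∈c₀ i ,
          ℚ.≤-reflexive (sym (ℚ.*-identityˡ t)))

  module _ (dec : (P : Set) → Dec P) (n : ℕ) (d : ℝ≥0) {t u : ℚ}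
           (t∈c₀ : below (c 0) t) (u∈d : below d u) where

    private
      S : ℚ → Set
      S s = y·hℚ s n ≤ d

      0<u = positive d u∈d

      S-bounded : ∃[ B ] 0ℚ ℚ.< B × (∀ s → B ℚ.< s → ¬ S s)
      S-bounded =
        let C , 0<C , C∉d = bounded d
            0<t = positive (c 0) t∈c₀
            e , 0<e , et≡C = quotient 0<C 0<t
            0<1 = ℚ.positive⁻¹ 1ℚ
            1<B = subst (ℚ._< e ℚ.+ 1ℚ) (ℚ.+-identityˡ 1ℚ) (ℚ.+-monoˡ-< 1ℚ 0<e)
            e<B = subst (ℚ._< e ℚ.+ 1ℚ) (ℚ.+-identityʳ e) (ℚ.+-monoʳ-< e 0<1)
            0<B = ℚ.<-trans 0<e e<B
        -- The bound e + 1 exceeds 1, so that `c₀≤horner` applies, and exceeds e = C / t, so that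
        -- its product with `t` exceeds `C`.
        in e ℚ.+ 1ℚ , 0<B , λ s B<s Ss →
           C∉d (lower d 0<C (subst (ℚ._< (e ℚ.+ 1ℚ) ℚ.* t) et≡C (*-monoˡ-< 0<t e<B))
             (Ss _ (·-∈ (rational s) (hℚ s n) (0<B , B<s) (c₀≤horner (ℚ.<-trans 1<B B<s) t∈c₀ n))))

      -- The supremum of `S`. Requiring q < s strictly makes the cut rounded.
      y : ℝ≥0
      y = record
        { below    = λ q → 0ℚ ℚ.< q × ∃[ s ] q ℚ.< s × S s
        ; positive = proj₁
        ; lower    = λ { 0<p p<q (_ , s , q<s , Ss) → 0<p , s , ℚ.<-trans p<q q<s , Ss }
        ; rounded  = λ { (0<p , s , p<s , Ss) →
            let q , p<q , q<s = ℚ.<-dense p<s in q , p<q , ℚ.<-trans 0<p p<q , s , q<s , Ss }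
        ; bounded  = let B , 0<B , ¬S = S-bounded in B , 0<B , λ { (_ , s , B<s , Ss) → ¬S s B<s Ss }
        }

      ∈-inhabited : ∃[ s ] below y s
      ∈-inhabited =
        -- With `R` a bound for the Horner value at 1, s = min(u / R, 1) keeps the product below (u
        -- / R) R = u. A smaller `s₀` is then strictly below a member of `S`.
        let R , 0<R , R∉h₁ = bounded (hℚ 1ℚ n)
            e , 0<e , eR≡u = quotient 0<u 0<R
            s = e ℚ.⊓ 1ℚ
            0<s = 0<⊓ e 0<e
            s₀ , 0<s₀ , s₀<s = ℚ.<-dense 0<s
            Ss : S s
            Ss = λ { w (0<w , a , b , (0<a , a<s) , b∈hₛ , w≤ab) →
              let b∈h₁ = horner-mono {rational s} {rational 1ℚ} (rational-mono (ℚ.p⊓q≤q e 1ℚ)) n b b∈hₛ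
                  a<e = ℚ.<-≤-trans a<s (ℚ.p⊓q≤p e 1ℚ)
                  b<R = below-bound (hℚ 1ℚ n) b∈h₁ 0<R R∉h₁
                  ab<eR = *-mono-< 0<e (positive (hℚ 1ℚ n) b∈h₁) a<e b<R
              in lower d 0<w (ℚ.≤-<-trans w≤ab (subst (a ℚ.* b ℚ.<_) eR≡u ab<eR)) u∈d }
        in s₀ , 0<s₀ , s , s₀<s , Ss
        where
        0<⊓ : ∀ e → 0ℚ ℚ.< e → 0ℚ ℚ.< e ℚ.⊓ 1ℚ
        0<⊓ e 0<e with ℚ.⊓-sel e 1ℚ
        ... | inj₁ ≡e = subst (0ℚ ℚ.<_) (sym ≡e) 0<e
        ... | inj₂ ≡1 = subst (0ℚ ℚ.<_) (sym ≡1) (ℚ.positive⁻¹ 1ℚ)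

      y·h≤d : y·h y n ≤ d
      y·h≤d w w∈ =
        let s , (_ , s′ , s<s′ , Ss′) , w∈′ = y·horner-leftContinuous y n w∈
        in Ss′ w (y·horner-mono {rational s} {rational s′} (rational-mono (ℚ.<⇒≤ s<s′)) n w w∈′)

      -- A gap above y · h y n would allow to enlarge y by a constant factor 1 / μ.
      gap⇒dilation : ∀ {v} → below d v → ¬ below (y·h y n) v →
                     ∃[ μ ] 0ℚ ℚ.< μ × μ ℚ.< 1ℚ × (∀ s → below y (μ ℚ.* s) → S s)
      gap⇒dilation {v} v∈d v∉ =
        let v′ , v<v′ , v′∈d = rounded d v∈d
            0<v = positive d v∈d
            κ , 0<κ , κ<1 , κv′≡v = quotient-< 0<v v<v′
            μ , 0<μ , μ<1 , shrink = y·horner-shrink n 0<κ κ<1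
        in μ , 0<μ , μ<1 , λ s μs∈y w w∈ → decide w (positive (y·hℚ s n) w∈) v∉ v′∈d 0<v 0<κ κv′≡v
             (y·horner-mono {rational (μ ℚ.* s)} {y} (rational-≤ y μs∈y) n _ (shrink s w w∈))
        where
        decide : ∀ w {κ v v′} → 0ℚ ℚ.< w → ¬ below (y·h y n) v → below d v′ → 0ℚ ℚ.< v → 0ℚ ℚ.< κ →
                 κ ℚ.* v′ ≡ v → below (y·h y n) (κ ℚ.* w) → below d w
        -- If `w` were not in `d`, then v′ < w, so v = κ v′ < κ w would put `v` below `y·h y n`.
        decide w {κ} 0<w v∉ v′∈d 0<v 0<κ κv′≡v κw∈ with dec (below d w)
        ... | yes w∈d = w∈d
        ... | no  w∉d = contradiction
          (lower (y·h y n) 0<v v<κw κw∈) v∉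
          where v<κw = subst (ℚ._< κ ℚ.* w) κv′≡v (*-monoʳ-< 0<κ (below-bound d v′∈d 0<w w∉d))

      -- Dilation by 1 / μ moves every member of `y` above `s₀` up by at least the fixed amount (1 -
      -- μ) s₀ without leaving `y`. Iterating contradicts boundedness.
      no-dilation : ∀ {μ} → 0ℚ ℚ.< μ → μ ℚ.< 1ℚ → ¬ (∀ s → below y (μ ℚ.* s) → S s)
      no-dilation {μ} 0<μ μ<1 dilate =
        let B , 0<B , B∉y = bounded y
            s , B≤s , s∈y = archimedean (below y) 0<ε s₀∈y step B
        in B∉y (lower-≤ y 0<B B≤s s∈y)
        where
        open +-*-Solver
        s₀ = proj₁ ∈-inhabited
        s₀∈y = proj₂ ∈-inhabited
        0<s₀ = positive y s₀∈y
        0<1-μ : 0ℚ ℚ.< 1ℚ ℚ.- μ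
        0<1-μ = subst (ℚ._< 1ℚ ℚ.- μ) (ℚ.+-inverseʳ μ) (ℚ.+-monoˡ-< (ℚ.- μ) μ<1)
        ε = (1ℚ ℚ.- μ) ℚ.* s₀
        0<ε = *-pos 0<1-μ 0<s₀
        step : ∀ {s} → s₀ ℚ.≤ s → below y s → below y (s ℚ.+ ε)
        step {s} s₀≤s s∈y =
          let s′ , s<s′ , s′∈y = rounded y s∈y
              0<s = positive y s∈y
              0<s+ε = subst (ℚ._< s ℚ.+ ε) (ℚ.+-identityʳ 0ℚ) (ℚ.+-mono-< 0<s 0<ε)
              s+ε<s′+ε = ℚ.+-monoˡ-< ε s<s′
              0<s′+ε = ℚ.<-trans 0<s+ε s+ε<s′+ε
              ε≤ : ε ℚ.≤ (1ℚ ℚ.- μ) ℚ.* s′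
              ε≤ = *-monoʳ-≤ 0<1-μ (ℚ.≤-trans s₀≤s (ℚ.<⇒≤ s<s′))
              -- Because μ ε < ε ≤ (1 - μ) s′.
              μ[s′+ε]<s′ : μ ℚ.* (s′ ℚ.+ ε) ℚ.< s′
              μ[s′+ε]<s′ = subst₂ ℚ._<_ (sym (ℚ.*-distribˡ-+ μ s′ ε))
                (solve 2 (λ m s → m :* s :+ (con 1ℚ :- m) :* s := s) refl μ s′)
                (ℚ.+-monoʳ-< (μ ℚ.* s′) (ℚ.<-≤-trans (p*q<q 0<ε μ<1) ε≤))
          in 0<s+ε , s′ ℚ.+ ε , s+ε<s′+ε ,
             dilate (s′ ℚ.+ ε) (lower y (*-pos 0<μ 0<s′+ε) μ[s′+ε]<s′ s′∈y)

      d≤y·h : d ≤ y·h y n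
      d≤y·h v v∈d with dec (below (y·h y n) v)
      ... | yes v∈ = v∈
      ... | no  v∉ = let _ , 0<μ , μ<1 , dilate = gap⇒dilation v∈d v∉
                   in ⊥-elim (no-dilation 0<μ μ<1 dilate)

    horner-solvable : ∃[ x ] x · horner c x n ≈ d
    horner-solvable = y , y·h≤d , d≤y·h

-- Index orders, gauges and peaks

record Splitting (_◁_ : ℕ → ℕ → Set) : Set where
  field
    -- These properties are shared by `_<_` and `_>_`, so one argument treats first and last
    -- indices. Each splitting says that a competing pair of indices has a component strictly on the
    -- `◁` side, where the peak is separated.
    irrefl  : ∀ {i} → ¬ i ◁ i
    split-≡ : ∀ {i j h k} → i ℕ.+ j ≡ h ℕ.+ k → i ≢ h → i ◁ h ⊎ j ◁ k
    split-◁ : ∀ {i j h k} → (i ℕ.+ j) ◁ (h ℕ.+ k) → i ◁ h ⊎ j ◁ k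

<-splitting : Splitting ℕ._<_
<-splitting = record
  { irrefl  = ℕ.<-irrefl refl
  ; split-≡ = split-≡
  ; split-◁ = λ {i} {j} {h} {k} → split-< {i} {j} {h} {k}
  }
  where
  split-≡ : ∀ {i j h k} → i ℕ.+ j ≡ h ℕ.+ k → i ≢ h → i ℕ.< h ⊎ j ℕ.< k
  split-≡ {i} {j} {h} {k} i+j≡h+k i≢h with ℕ.<-cmp i h
  ... | tri< i<h _ _ = inj₁ i<h
  ... | tri≈ _ i≡h _ = contradiction i≡h i≢h
  ... | tri> _ _ h<i = inj₂ (ℕ.≰⇒> λ k≤j → ℕ.<⇒≢ (ℕ.+-mono-<-≤ h<i k≤j) (sym i+j≡h+k))
  split-< : ∀ {i j h k} → i ℕ.+ j ℕ.< h ℕ.+ k → i ℕ.< h ⊎ j ℕ.< k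
  split-< {i} {j} {h} {k} i+j<h+k with ℕ.<-≤-connex i h
  ... | inj₁ i<h = inj₁ i<h
  ... | inj₂ h≤i = inj₂ (ℕ.≰⇒> λ k≤j → ℕ.<⇒≱ i+j<h+k (ℕ.+-mono-≤ h≤i k≤j))

>-splitting : Splitting ℕ._>_
>-splitting = record
  { irrefl  = Splitting.irrefl <-splitting
  ; split-≡ = λ i+j≡h+k i≢h → Splitting.split-≡ <-splitting (sym i+j≡h+k) (i≢h ∘ sym)
  ; split-◁ = λ {i} {j} {h} {k} → Splitting.split-◁ <-splitting {h} {k} {i} {j}
  }

-- ν i a measures the monomial aTⁱ.
record Gauge : Set₁ where
  field
    ν    : ℕ → ℝ≥0 → ℝ≥0
    mono : ∀ i {x y} → x ≤ y → ν i x ≤ ν i y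
    homo : ∀ i j x y → ν (i ℕ.+ j) (x · y) ≈ ν i x · ν j y
    null : ∀ i {x} → x ≈ 0# → ν i x ≈ 0#

  cong-ν : ∀ i {x y} → x ≈ y → ν i x ≈ ν i y
  cong-ν i {x} {y} (x≤y , y≤x) = mono i {x} {y} x≤y , mono i {y} {x} y≤x

-- For _<_ and _>_ in place of _◁_, h is the first and the last index of a largest monomial.
record Peak (_◁_ : ℕ → ℕ → Set) (G : Gauge) (p : Poly) (h : ℕ) : Set where
  open Gauge G
  field
    nonzero   : ν h (coeff p h) ≉ 0#
    maximal   : ∀ i → ν i (coeff p i) ≤ ν h (coeff p h)
    separated : ∀ i → i ◁ h → ν i (coeff p i) < ν h (coeff p h)

-- The monoid being multiplicative, `i ×ᵐ x` is the i-th power of `x`; the gauge is the value of the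
-- monomial at `x`.
pointGauge : ℝ≥0 → Gauge
pointGauge x = record
  { ν    = λ i a → a · (i ×ᵐ x)
  ; mono = λ i {a} {b} a≤b → ·-mono {a} {b} {i ×ᵐ x} {i ×ᵐ x} a≤b (≤-refl {i ×ᵐ x})
  ; homo = λ i j a b → ≈-trans {a · b · ((i ℕ.+ j) ×ᵐ x)} {a · b · ((i ×ᵐ x) · (j ×ᵐ x))}
      {a · (i ×ᵐ x) · (b · (j ×ᵐ x))}
      (·-congˡ (a · b) {(i ℕ.+ j) ×ᵐ x} {(i ×ᵐ x) · (j ×ᵐ x)} (×-homo-+ x i j))
      (interchange a b (i ×ᵐ x) (j ×ᵐ x))
  ; null = λ i {a} → ·-zeroˡ {a} (i ×ᵐ x)
  }

-- Matching two families by counting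

sum≢0⇒∃≢0 : ∀ {n} (f : Fin n → ℕ) → sum f ≢ 0 → ∃[ i ] f i ≢ 0
sum≢0⇒∃≢0 {zero}  f ∑≢0 = contradiction refl ∑≢0
sum≢0⇒∃≢0 {suc n} f ∑≢0 with f Fin.zero ℕ.≟ 0
... | no  f₀≢0 = Fin.zero , f₀≢0
... | yes f₀≡0 =
  let i , fᵢ≢0 = sum≢0⇒∃≢0 (f ∘ Fin.suc) λ ∑≡0 →
        ∑≢0 (trans (cong (ℕ._+ sum (f ∘ Fin.suc)) f₀≡0) ∑≡0)
  in Fin.suc i , fᵢ≢0

module _ {a} {A : Set a} (e : A → A → ℕ) (e-refl : ∀ s → e s s ≢ 0)
         (e-resp : ∀ {s t} → e s t ≢ 0 → ∀ r → e r s ≡ e r t) where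

  -- Think of `e s t` as the indicator of an equivalence relation, so that the sums count members of
  -- a class. The first member of `f` is counted at least once in `f`, hence in `g`, which yields a
  -- partner; deleting both leaves all counts equal.
  match : ∀ {n m} (f : Fin n → A) (g : Fin m → A) → (∀ s → sum (e s ∘ f) ≡ sum (e s ∘ g)) →
          n ≡ m × (Σ[ σ ∈ Permutation n m ] ∀ i → e (f i) (g (σ ⟨$⟩ʳ i)) ≢ 0)
  match {zero}  {zero}  f g ∑≡ = refl , id↔ , λ ()
  match {zero}  {suc m} f g ∑≡ = contradiction (ℕ.m+n≡0⇒m≡0 _ (sym (∑≡ (g Fin.zero)))) (e-refl (g Fin.zero))
  match {suc n} {zero}  f g ∑≡ = contradiction (ℕ.m+n≡0⇒m≡0 _ (∑≡ (f Fin.zero))) (e-refl (f Fin.zero))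
  match {suc n} {suc m} f g ∑≡ =
    let n≡m , σ , related = match (f ∘ Fin.suc) (g ∘ punchIn j) ∑≡′
    in cong suc n≡m , insert Fin.zero j σ , λ
      { Fin.zero    → f₀~gⱼ
      ; (Fin.suc i) → subst (λ k → e (f (Fin.suc i)) (g k) ≢ 0)
          (sym (insert-punchIn Fin.zero j σ i)) (related i) }
    where
    f₀ = f Fin.zero
    partner : ∃[ j ] e f₀ (g j) ≢ 0
    partner = sum≢0⇒∃≢0 (e f₀ ∘ g) λ ∑≡0 → e-refl f₀ (ℕ.m+n≡0⇒m≡0 _ (trans (∑≡ f₀) ∑≡0))
    j = proj₁ partner
    f₀~gⱼ = proj₂ partner
    ∑≡′ : ∀ s → sum (e s ∘ f ∘ Fin.suc) ≡ sum (e s ∘ g ∘ punchIn j)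
    ∑≡′ s = ℕ.+-cancelˡ-≡ (e s f₀) _ _ (trans (∑≡ s) (trans (sum-remove {i = j} (e s ∘ g))
      (cong (ℕ._+ sum (e s ∘ g ∘ punchIn j)) (sym (e-resp f₀~gⱼ s)))))

bit : ∀ {a} {A : Set a} → Dec A → ℕ
bit (yes _) = 1
bit (no  _) = 0

bit-yes : ∀ {a} {A : Set a} (d : Dec A) → A → bit d ≡ 1
bit-yes (yes _) a = refl
bit-yes (no ¬a) a = contradiction a ¬a

bit-no : ∀ {a} {A : Set a} (d : Dec A) → ¬ A → bit d ≡ 0
bit-no (yes a) ¬a = contradiction a ¬a
bit-no (no  _) ¬a = refl

bit≢0 : ∀ {a} {A : Set a} (d : Dec A) → bit d ≢ 0 → A
bit≢0 (yes a) _   = a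
bit≢0 (no  _) 0≢0 = contradiction refl 0≢0

-- Total order, division and cancellation from excluded middle

module Classical (em : ExcludedMiddle (lsuc 0ℓ)) where

  -- Excluded middle is assumed one level up, where `_∼_` lives; small propositions are lifted
  -- there.
  dec : (P : Set) → Dec P
  dec P = map′ Lift.lower lift (em {Lift (lsuc 0ℓ) P})

  ≤-total : ∀ x y → x ≤ y ⊎ y ≤ x
  ≤-total x y with dec (∃[ q ] below x q × ¬ below y q)
  ... | yes (q , q∈x , q∉y) = inj₂ λ p p∈y →
    lower x (positive y p∈y) (below-bound y p∈y (positive x q∈x) q∉y) q∈x
  ... | no  ∄q = inj₁ λ q q∈x → case-∈ q q∈x (dec (below y q))
    where
    case-∈ : ∀ q → below x q → Dec (below y q) → below y q
    case-∈ q q∈x (yes q∈y) = q∈y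
    case-∈ q q∈x (no  q∉y) = contradiction (q , q∈x , q∉y) ∄q

  <⇒≤ : ∀ {x y} → x < y → x ≤ y
  <⇒≤ {x} {y} x<y with ≤-total x y
  ... | inj₁ x≤y = x≤y
  ... | inj₂ y≤x = contradiction y≤x (<⇒≰ x<y)

  ≤-or-> : ∀ x y → x ≤ y ⊎ y < x
  ≤-or-> x y with dec (x ≤ y)
  ... | yes x≤y = inj₁ x≤y
  ... | no  x≰y = inj₂ (≰⇒< x≰y)

  module ≤-Reasoning = Triple {_≈_ = _≈_} {_≤_ = _≤_} {_<_ = _<_}
    ≤-isPreorder
    (λ {x} {y} x<y y<x → <⇒≰ x<y (<⇒≤ {y} {x} y<x))
    (λ {x} {y} {z} x<y y<z → <-≤-trans {x} {y} {z} x<y (<⇒≤ {y} {z} y<z))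
    ( (λ {x} {y} {z} y≈z x<y → <-≤-trans {x} {y} {z} x<y (proj₁ y≈z))
    , (λ {x} {y} {z} y≈z y<x → ≤-<-trans {z} {y} {x} (proj₂ y≈z) y<x))
    (λ {x} {y} → <⇒≤ {x} {y})
    (λ {x} {y} {z} → <-≤-trans {x} {y} {z})
    (λ {x} {y} {z} → ≤-<-trans {x} {y} {z})

  ≉0⇒∈ : ∀ {x} → x ≉ 0# → ∃[ q ] below x q
  ≉0⇒∈ {x} x≉0 with dec (∃[ q ] below x q)
  ... | yes q∈x = q∈x
  ... | no  ∄q  = contradiction (≤0⇒≈0 {x} λ q q∈x → ∄q (q , q∈x)) x≉0

  ·-≉0 : ∀ x y → x ≉ 0# → y ≉ 0# → x · y ≉ 0#
  ·-≉0 x y x≉0 y≉0 =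
    let _ , a∈x = ≉0⇒∈ {x} x≉0
        _ , b∈y = ≉0⇒∈ {y} y≉0
    in ∈⇒≉0 {x · y} (·-∈ x y a∈x b∈y)

  horner-solution : ∀ c n d → c 0 ≉ 0# → d ≉ 0# → ∃[ x ] x · horner c x n ≈ d
  horner-solution c n d c₀≉0 d≉0 =
    horner-solvable c dec n d (proj₂ (≉0⇒∈ {c 0} c₀≉0)) (proj₂ (≉0⇒∈ {d} d≉0))

  -- Division is the Horner equation of index 0 with the constant sequence `y`. A zero dividend is
  -- separate since `horner-solution` asks for a nonzero right-hand side.
  divide : ∀ x {y} → y ≉ 0# → ∃[ z ] z · y ≈ x
  divide x {y} y≉0 with dec (x ≈ 0#)
  ... | yes x≈0 = 0# , ≈-trans {0# · y} {0#} {x} (·-zeroˡ {0#} y (≈-refl {0#})) (≈-sym {x} {0#} x≈0)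
  ... | no  x≉0 = horner-solution (λ _ → y) 0 x y≉0 x≉0

  ·-cancelʳ-≤ : ∀ x y {z} → z ≉ 0# → x · z ≤ y · z → x ≤ y
  ·-cancelʳ-≤ x y {z} z≉0 xz≤yz = begin
    x            ≈⟨ ≈-sym {x · z · w} {x} (undo x) ⟩
    x · z · w    ≤⟨ ·-mono {x · z} {y · z} {w} {w} xz≤yz (≤-refl {w}) ⟩
    y · z · w    ≈⟨ undo y ⟩
    y            ∎
    where
    open ≤-Reasoning
    w = proj₁ (divide 1# {z} z≉0)
    undo : ∀ v → v · z · w ≈ v
    undo v = begin-equality
      v · z · w    ≈⟨ ·-assoc v z w ⟩
      v · (z · w)  ≈⟨ ·-cong {v} {v} {z · w} {w · z} (≈-refl {v}) (·-comm z w) ⟩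
      v · (w · z)  ≈⟨ ·-cong {v} {v} {w · z} {1#} (≈-refl {v}) (proj₂ (divide 1# {z} z≉0)) ⟩
      v · 1#       ≈⟨ ·-identityʳ v ⟩
      v            ∎

  ·-mono-<-≤ : ∀ {x x′ y y′} → x < x′ → y ≤ y′ → y′ ≉ 0# → x · y < x′ · y′
  ·-mono-<-≤ {x} {x′} {y} {y′} x<x′ y≤y′ y′≉0 = ≰⇒< λ x′y′≤xy →
    <⇒≰ x<x′ (·-cancelʳ-≤ x′ x {y′} y′≉0
      (≤-trans {x′ · y′} {x · y} {x · y′} x′y′≤xy (·-mono {x} {x} {y} {y′} (≤-refl {x}) y≤y′)))

  ·-mono-≤-< : ∀ {x x′ y y′} → x ≤ x′ → y < y′ → x′ ≉ 0# → x · y < x′ · y′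
  ·-mono-≤-< {x} {x′} {y} {y′} x≤x′ y<y′ x′≉0 = begin-strict
    x · y    ≈⟨ ·-comm x y ⟩
    y · x    <⟨ ·-mono-<-≤ {y} {y′} {x} {x′} y<y′ x≤x′ x′≉0 ⟩
    y′ · x′  ≈⟨ ·-comm y′ x′ ⟩
    x′ · y′  ∎
    where open ≤-Reasoning

  -- Hyperaddition

  ⊞⇒≤ : ∀ x b c → x ∈ b ⊞ c → x ≤ b ⊎ x ≤ c
  ⊞⇒≤ x b c (inj₂ (_ , x≤b)) = inj₁ x≤b
  ⊞⇒≤ x b c (inj₁ (_ , x≤b⊔c , _)) with ≤-total b c
  ... | inj₁ b≤c = inj₂ (≤-trans {x} {b ⊔ c} {c} x≤b⊔c (⊔-lub {b} {c} {c} b≤c (≤-refl {c})))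
  ... | inj₂ c≤b = inj₁ (≤-trans {x} {b ⊔ c} {b} x≤b⊔c (⊔-lub {b} {c} {b} (≤-refl {b}) c≤b))

  ⊞-dominantˡ : ∀ {x b c} → c < b → x ∈ b ⊞ c → x ≈ b
  ⊞-dominantˡ c<b (inj₂ ((b≤c , _) , _)) = contradiction b≤c (<⇒≰ c<b)
  ⊞-dominantˡ {x} {b} {c} c<b (inj₁ (_ , x≈b⊔c)) = ≈-trans {x} {b ⊔ c} {b} x≈b⊔c
    (⊔-lub {b} {c} {b} (≤-refl {b}) (<⇒≤ {c} {b} c<b) , x≤x⊔y b c)

  ⊞-dominantʳ : ∀ {x b c} → b < c → x ∈ b ⊞ c → x ≈ c
  ⊞-dominantʳ b<c (inj₂ ((_ , c≤b) , _)) = contradiction c≤b (<⇒≰ b<c)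
  ⊞-dominantʳ {x} {b} {c} b<c (inj₁ (_ , x≈b⊔c)) = ≈-trans {x} {b ⊔ c} {c} x≈b⊔c
    (⊔-lub {b} {c} {c} (<⇒≤ {b} {c} b<c) (≤-refl {c}) , y≤x⊔y b c)

  ∈⊞0 : ∀ {x c} → c ≈ 0# → x ∈ x ⊞ c
  ∈⊞0 {x} {c} (c≤0 , 0≤c) with dec (x ≈ c)
  ... | yes x≈c = inj₂ (x≈c , ≤-refl {x})
  ... | no  x≉c = inj₁ (x≉c , x≤x⊔y x c ,
    ⊔-lub {x} {c} {x} (≤-refl {x}) (≤-trans {c} {0#} {x} c≤0 (0≤ x)))

  ∈0⊞ : ∀ {x b c} → b ≈ 0# → x ≈ c → x ∈ b ⊞ c
  ∈0⊞ {x} {b} {c} (b≤0 , 0≤b) (x≤c , c≤x) with dec (b ≈ c)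
  ... | yes b≈c = inj₂ (b≈c , ≤-trans {x} {c} {b} x≤c (proj₂ b≈c))
  ... | no  b≉c = inj₁ (b≉c , ≤-trans {x} {c} {b ⊔ c} x≤c (y≤x⊔y b c) ,
    ⊔-lub {b} {c} {x} (≤-trans {b} {0#} {x} b≤0 (0≤ x)) c≤x)

  -- Among `x`, `y` and their maximum, the largest value occurs twice. This is why the recursion rᵢ
  -- = pᵢ ⊔ y rᵢ₋₁ solves the coefficient conditions of a product with 1 + yT.
  ∈⊔⊞ : ∀ x y → x ∈ x ⊔ y ⊞ y
  ∈⊔⊞ x y with dec (x ⊔ y ≈ y)
  ... | yes x⊔y≈y = inj₂ (x⊔y≈y , x≤x⊔y x y)
  ... | no  x⊔y≉y = inj₁ (x⊔y≉y , ≤-trans {x} {x ⊔ y} {x ⊔ y ⊔ y} (x≤x⊔y x y) (x≤x⊔y (x ⊔ y) y) ,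
                    ⊔-lub {x ⊔ y} {y} {x} (⊔-lub {x} {y} {x} (≤-refl {x}) y≤x) y≤x)
    where
    y≤x : y ≤ x
    y≤x with ≤-total x y
    ... | inj₂ y≤x = y≤x
    ... | inj₁ x≤y = contradiction (⊔-lub {x} {y} {y} x≤y (≤-refl {y}) , y≤x⊔y x y) x⊔y≉y

  ⊞-resp-≈ : ∀ {x b b′ c c′} → b ≈ b′ → c ≈ c′ → x ∈ b ⊞ c → x ∈ b′ ⊞ c′
  ⊞-resp-≈ {x} {b} {b′} {c} {c′} b≈b′ c≈c′ (inj₂ (b≈c , x≤b)) = inj₂
    ( ≈-trans {b′} {b} {c′} (≈-sym {b} {b′} b≈b′) (≈-trans {b} {c} {c′} b≈c c≈c′)
    , ≤-trans {x} {b} {b′} x≤b (proj₁ b≈b′))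
  ⊞-resp-≈ {x} {b} {b′} {c} {c′} b≈b′ c≈c′ (inj₁ (b≉c , x≈b⊔c)) = inj₁
    ( (λ b′≈c′ → b≉c (≈-trans {b} {b′} {c} b≈b′ (≈-trans {b′} {c′} {c} b′≈c′ (≈-sym {c} {c′} c≈c′))))
    , ≈-trans {x} {b ⊔ c} {b′ ⊔ c′} x≈b⊔c
      ( ⊔-lub {b} {c} {b′ ⊔ c′} (≤-trans {b} {b′} {b′ ⊔ c′} (proj₁ b≈b′) (x≤x⊔y b′ c′))
                                (≤-trans {c} {c′} {b′ ⊔ c′} (proj₁ c≈c′) (y≤x⊔y b′ c′))
      , ⊔-lub {b′} {c′} {b ⊔ c} (≤-trans {b′} {b} {b ⊔ c} (proj₂ b≈b′) (x≤x⊔y b c))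
                                (≤-trans {c′} {c} {b ⊔ c} (proj₂ c≈c′) (y≤x⊔y b c))))

  ∈⊞⇒≤ : ∀ n {x a} → x ∈⊞[ n ] a → ∃[ i ] i ℕ.≤ n × x ≤ a i
  ∈⊞⇒≤ zero    (lift (x≤a₀ , _)) = 0 , ℕ.≤-refl , x≤a₀
  ∈⊞⇒≤ (suc n) {x} {a} (b , b∈ , x∈) with ⊞⇒≤ x b (a (suc n)) x∈
  ... | inj₂ x≤a = suc n , ℕ.≤-refl , x≤a
  ... | inj₁ x≤b = let i , i≤n , b≤a = ∈⊞⇒≤ n b∈ in i , ℕ.m≤n⇒m≤1+n i≤n , ≤-trans {x} {b} {a i} x≤b b≤a

  -- A partial sum never exceeds all of its summands, so it is strictly below `a j` before index `j`
  -- is reached; from then on `a j` absorbs everything that is added.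
  ∈⊞-dominant : ∀ n {x a j} → j ℕ.≤ n → (∀ {i} → i ℕ.≤ n → i ≢ j → a i < a j) → x ∈⊞[ n ] a → x ≈ a j
  ∈⊞-dominant zero    ℕ.z≤n dom (lift x≈a₀) = x≈a₀
  ∈⊞-dominant (suc n) {x} {a} {j} j≤1+n dom (b , b∈ , x∈) with ℕ.m≤n⇒m<n∨m≡n j≤1+n
  ... | inj₂ refl = let i , i≤n , b≤aᵢ = ∈⊞⇒≤ n b∈ in
    ⊞-dominantʳ {x} {b} {a j}
      (≤-<-trans {b} {a i} {a j} b≤aᵢ (dom (ℕ.m≤n⇒m≤1+n i≤n) (ℕ.<⇒≢ (ℕ.s≤s i≤n)))) x∈
  ... | inj₁ (ℕ.s≤s j≤n) =
    let b≈aⱼ = ∈⊞-dominant n j≤n (λ i≤n → dom (ℕ.m≤n⇒m≤1+n i≤n)) b∈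
        a<b = <-≤-trans {a (suc n)} {a j} {b} (dom ℕ.≤-refl (ℕ.<⇒≢ (ℕ.s≤s j≤n) ∘ sym)) (proj₂ b≈aⱼ)
    in ≈-trans {x} {b} {a j} (⊞-dominantˡ {x} {b} {a (suc n)} a<b x∈) b≈aⱼ

  -- Strict dominance covers a nonzero `a j`. If `a j` vanishes as well, every summand is zero and
  -- so is the sum.
  ∈⊞-single : ∀ n {x a j} → j ℕ.≤ n → (∀ {i} → i ℕ.≤ n → i ≢ j → a i ≈ 0#) → x ∈⊞[ n ] a → x ≈ a j
  ∈⊞-single n {x} {a} {j} j≤n others x∈ with dec (a j ≈ 0#)
  ... | no  aⱼ≉0 = ∈⊞-dominant n j≤n (λ {i} i≤n i≢j → ≈0<≉0 {a i} {a j} (others i≤n i≢j) aⱼ≉0) x∈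
  ... | yes aⱼ≈0 = let i , i≤n , x≤aᵢ = ∈⊞⇒≤ n x∈ in
    ≈-trans {x} {0#} {a j} (≤0⇒≈0 {x} (≤-trans {x} {a i} {0#} x≤aᵢ (proj₁ (all-zero i i≤n))))
            (≈-sym {a j} {0#} aⱼ≈0)
    where
    all-zero : ∀ i → i ℕ.≤ n → a i ≈ 0#
    all-zero i i≤n with i ℕ.≟ j
    ... | yes refl = aⱼ≈0
    ... | no  i≢j  = others i≤n i≢j

  ∈⊞-extend : ∀ {m n x a} → m ℕ.≤′ n → (∀ {i} → m ℕ.< i → a i ≈ 0#) → x ∈⊞[ m ] a → x ∈⊞[ n ] a
  ∈⊞-extend ℕ.≤′-refl zeros x∈ = x∈
  ∈⊞-extend {n = suc n} {x} {a} (ℕ.≤′-step m≤n) zeros x∈ =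
    x , ∈⊞-extend m≤n zeros x∈ , ∈⊞0 {x} {a (suc n)} (zeros (ℕ.s≤s (ℕ.≤′⇒≤ m≤n)))

  -- Peaks of products

  ⊡⇒≤ : ∀ p q r → p ∈ q ⊡ r → ∀ l → ∃[ i ] ∃[ j ] i ℕ.+ j ≡ l × coeff p l ≤ coeff q i · coeff r j
  ⊡⇒≤ p q r p∈ l = let i , i≤l , p≤ = ∈⊞⇒≤ l (p∈ l) in i , l ∸ i , ℕ.m+[n∸m]≡n i≤l , p≤

  module _ {_◁_ : ℕ → ℕ → Set} (S : Splitting _◁_) (G : Gauge) where
    open Splitting S
    open Gauge G
    open Peak

    peak-unique : ∀ {p h k} → Peak _◁_ G p h → Peak _◁_ G p k → h ≡ k
    peak-unique {p} {h} {k} at-h at-k with h ℕ.≟ k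
    ... | yes h≡k = h≡k
    -- Splitting h + k = k + h yields trichotomy: one index precedes the other, and separation at
    -- the later one contradicts maximality at the earlier.
    ... | no  h≢k with split-≡ {h} {k} {k} {h} (ℕ.+-comm h k) h≢k
    ...   | inj₁ h◁k = contradiction (maximal at-h k) (<⇒≰ (separated at-k h h◁k))
    ...   | inj₂ k◁h = contradiction (maximal at-k h) (<⇒≰ (separated at-h k k◁h))

    peak-cong : ∀ {p q h} → p ≈ₚ q → Peak _◁_ G q h → Peak _◁_ G p h
    peak-cong {p} {q} {h} p≈q peak = record
      { nonzero   = ≉0-resp-≤ {ν h (coeff q h)} {ν h (coeff p h)} (proj₂ (ν≈ h)) (nonzero peak)
      ; maximal   = λ i → begin
          ν i (coeff p i)  ≈⟨ ν≈ i ⟩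
          ν i (coeff q i)  ≤⟨ maximal peak i ⟩
          ν h (coeff q h)  ≈⟨ ≈-sym {ν h (coeff p h)} {ν h (coeff q h)} (ν≈ h) ⟩
          ν h (coeff p h)  ∎
      ; separated = λ i i◁h → begin-strict
          ν i (coeff p i)  ≈⟨ ν≈ i ⟩
          ν i (coeff q i)  <⟨ separated peak i i◁h ⟩
          ν h (coeff q h)  ≈⟨ ≈-sym {ν h (coeff p h)} {ν h (coeff q h)} (ν≈ h) ⟩
          ν h (coeff p h)  ∎
      }
      where
      open ≤-Reasoning
      ν≈ : ∀ i → ν i (coeff p i) ≈ ν i (coeff q i)
      ν≈ i = cong-ν i {coeff p i} {coeff q i} (p≈q i)

    peak-⊡ : ∀ {p q r h k} → Peak _◁_ G q h → Peak _◁_ G r k → p ∈ q ⊡ r → Peak _◁_ G p (h ℕ.+ k)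
    peak-⊡ {p} {q} {r} {h} {k} at-h at-k p∈ = record
      { nonzero   = ≉0-resp-≤ {V · W} {ν (h ℕ.+ k) (coeff p (h ℕ.+ k))} (proj₂ ν-lead)
                    (·-≉0 V W (nonzero at-h) (nonzero at-k))
      ; maximal   = maximal′
      ; separated = separated′
      }
      where
      open ≤-Reasoning
      V W : ℝ≥0
      V = ν h (coeff q h)
      W = ν k (coeff r k)
      term : ℕ → ℕ → ℝ≥0
      term i j = coeff q i · coeff r j

      term-≤ : ∀ i j → ν (i ℕ.+ j) (term i j) ≤ V · W
      term-≤ i j = begin
        ν (i ℕ.+ j) (term i j)             ≈⟨ homo i j (coeff q i) (coeff r j) ⟩
        ν i (coeff q i) · ν j (coeff r j)  ≤⟨ ·-mono {ν i (coeff q i)} {V} {ν j (coeff r j)} {W}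
                                                     (maximal at-h i) (maximal at-k j) ⟩
        V · W                              ∎

      factors-< : ∀ i j → i ◁ h ⊎ j ◁ k → ν i (coeff q i) · ν j (coeff r j) < V · W
      factors-< i j (inj₁ i◁h) = ·-mono-<-≤ {ν i (coeff q i)} {V} {ν j (coeff r j)} {W}
        (separated at-h i i◁h) (maximal at-k j) (nonzero at-k)
      factors-< i j (inj₂ j◁k) = ·-mono-≤-< {ν i (coeff q i)} {V} {ν j (coeff r j)} {W}
        (maximal at-h i) (separated at-k j j◁k) (nonzero at-h)

      term-< : ∀ i j → i ◁ h ⊎ j ◁ k → ν (i ℕ.+ j) (term i j) < V · W
      term-< i j ◁ = begin-strict
        ν (i ℕ.+ j) (term i j)             ≈⟨ homo i j (coeff q i) (coeff r j) ⟩
        ν i (coeff q i) · ν j (coeff r j)  <⟨ factors-< i j ◁ ⟩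
        V · W                              ∎

      -- At a common total index the gauge is monotone, so a strict inequality between gauged terms
      -- reflects to the terms themselves. This makes the hypersum single-valued there.
      dominated : ∀ i j → i ℕ.+ j ≡ h ℕ.+ k → i ≢ h → term i j < term h k
      dominated i j i+j≡h+k i≢h = ≰⇒< λ hk≤ij → <⇒≰ (term-< i j (split-≡ i+j≡h+k i≢h)) (begin
        V · W                     ≈⟨ ≈-sym {ν (h ℕ.+ k) (term h k)} {V · W} (homo h k (coeff q h) (coeff r k)) ⟩
        ν (h ℕ.+ k) (term h k)    ≤⟨ mono (h ℕ.+ k) {term h k} {term i j} hk≤ij ⟩
        ν (h ℕ.+ k) (term i j)    ≡⟨ cong (λ l → ν l (term i j)) (sym i+j≡h+k) ⟩
        ν (i ℕ.+ j) (term i j)    ∎)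

      lead : coeff p (h ℕ.+ k) ≈ term h k
      lead = subst (λ j → coeff p (h ℕ.+ k) ≈ term h j) (ℕ.m+n∸m≡n h k)
        (∈⊞-dominant (h ℕ.+ k) {coeff p (h ℕ.+ k)} {j = h} (ℕ.m≤m+n h k)
          (λ {i} i≤ i≢h → subst (λ j → term i (h ℕ.+ k ∸ i) < term h j) (sym (ℕ.m+n∸m≡n h k))
            (dominated i (h ℕ.+ k ∸ i) (ℕ.m+[n∸m]≡n i≤) i≢h))
          (p∈ (h ℕ.+ k)))

      ν-lead : ν (h ℕ.+ k) (coeff p (h ℕ.+ k)) ≈ V · W
      ν-lead = begin-equality
        ν (h ℕ.+ k) (coeff p (h ℕ.+ k))  ≈⟨ cong-ν (h ℕ.+ k) {coeff p (h ℕ.+ k)} {term h k} lead ⟩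
        ν (h ℕ.+ k) (term h k)           ≈⟨ homo h k (coeff q h) (coeff r k) ⟩
        V · W                            ∎

      maximal′ : ∀ l → ν l (coeff p l) ≤ ν (h ℕ.+ k) (coeff p (h ℕ.+ k))
      maximal′ l with ⊡⇒≤ p q r p∈ l
      ... | i , j , refl , p≤ = begin
        ν (i ℕ.+ j) (coeff p (i ℕ.+ j))  ≤⟨ mono (i ℕ.+ j) {coeff p (i ℕ.+ j)} {term i j} p≤ ⟩
        ν (i ℕ.+ j) (term i j)           ≤⟨ term-≤ i j ⟩
        V · W                            ≈⟨ ≈-sym {ν (h ℕ.+ k) (coeff p (h ℕ.+ k))} {V · W} ν-lead ⟩
        ν (h ℕ.+ k) (coeff p (h ℕ.+ k))  ∎

      separated′ : ∀ l → l ◁ (h ℕ.+ k) → ν l (coeff p l) < ν (h ℕ.+ k) (coeff p (h ℕ.+ k))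
      separated′ l l◁h+k with ⊡⇒≤ p q r p∈ l
      ... | i , j , refl , p≤ = begin-strict
        ν (i ℕ.+ j) (coeff p (i ℕ.+ j))  ≤⟨ mono (i ℕ.+ j) {coeff p (i ℕ.+ j)} {term i j} p≤ ⟩
        ν (i ℕ.+ j) (term i j)           <⟨ term-< i j (split-◁ {i} {j} {h} {k} l◁h+k) ⟩
        V · W                            ≈⟨ ≈-sym {ν (h ℕ.+ k) (coeff p (h ℕ.+ k))} {V · W} ν-lead ⟩
        ν (h ℕ.+ k) (coeff p (h ℕ.+ k))  ∎

    peak-⊡* : ∀ {n p} (q : Fin (suc n) → Poly) (e : Fin (suc n) → ℕ) →
              (∀ i → Peak _◁_ G (q i) (e i)) → p ∈⊡ q → Peak _◁_ G p (sum e)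
    peak-⊡* {zero}  {p} q e peaks (lift p≈q₀) =
      subst (Peak _◁_ G p) (sym (ℕ.+-identityʳ (e Fin.zero))) (peak-cong {p} {q Fin.zero} p≈q₀ (peaks Fin.zero))
    peak-⊡* {suc n} {p} q e peaks (r , r∈ , p∈) =
      subst (Peak _◁_ G p) (sym (sum-init-last e))
        (peak-⊡ {p} {r} {q (fromℕ (suc n))}
          (peak-⊡* {n} {r} (q ∘ inject₁) (e ∘ inject₁) (peaks ∘ inject₁) r∈)
          (peaks (fromℕ (suc n))) p∈)

    module _ {q : Poly} (q-linear : HasDegree q 1) where

      private
        higher : ∀ i → ν (2 ℕ.+ i) (coeff q (2 ℕ.+ i)) ≈ 0#
        higher i = null (2 ℕ.+ i) {coeff q (2 ℕ.+ i)} (proj₂ q-linear (2 ℕ.+ i) (ℕ.s≤s (ℕ.s≤s ℕ.z≤n)))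

        ν₀ ν₁ : ℝ≥0
        ν₀ = ν 0 (coeff q 0)
        ν₁ = ν 1 (coeff q 1)

        higher-≤ : ∀ i v → ν (2 ℕ.+ i) (coeff q (2 ℕ.+ i)) ≤ v
        higher-≤ i v = ≤-trans {ν (2 ℕ.+ i) (coeff q (2 ℕ.+ i))} {0#} {v} (proj₁ (higher i)) (0≤ v)

      -- Only indices 0 and 1 compete. Strictness is asked for only under `1 ◁ 0`: a tie still
      -- leaves 0 the first index, but not the last.
      linear-peak₀ : ν₀ ≉ 0# → ν₁ ≤ ν₀ → (1 ◁ 0 → ν₁ < ν₀) → Peak _◁_ G q 0
      linear-peak₀ ν₀≉0 ν₁≤ν₀ ν₁<ν₀ = record
        { nonzero   = ν₀≉0
        ; maximal   = λ { 0 → ≤-refl {ν₀} ; 1 → ν₁≤ν₀ ; (suc (suc i)) → higher-≤ i ν₀ }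
        ; separated = λ { 0 0◁0 → contradiction 0◁0 irrefl
                      ; 1 1◁0 → ν₁<ν₀ 1◁0
                      ; (suc (suc i)) _ → ≈0<≉0 {ν (2 ℕ.+ i) (coeff q (2 ℕ.+ i))} {ν₀} (higher i) ν₀≉0 }
        }

      linear-peak₁ : ν₁ ≉ 0# → ν₀ ≤ ν₁ → (0 ◁ 1 → ν₀ < ν₁) → Peak _◁_ G q 1
      linear-peak₁ ν₁≉0 ν₀≤ν₁ ν₀<ν₁ = record
        { nonzero   = ν₁≉0
        ; maximal   = λ { 0 → ν₀≤ν₁ ; 1 → ≤-refl {ν₁} ; (suc (suc i)) → higher-≤ i ν₁ }
        ; separated = λ { 0 0◁1 → ν₀<ν₁ 0◁1
                      ; 1 1◁1 → contradiction 1◁1 irrefl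
                      ; (suc (suc i)) _ → ≈0<≉0 {ν (2 ℕ.+ i) (coeff q (2 ℕ.+ i))} {ν₁} (higher i) ν₁≉0 }
        }

  -- The trivial gauge

  indicator : ∀ {P : Set} → Dec P → ℝ≥0
  indicator (yes _) = 0#
  indicator (no  _) = 1#

  trivial : ℝ≥0 → ℝ≥0
  trivial x = indicator (dec (x ≈ 0#))

  trivial-≈0 : ∀ {x} → x ≈ 0# → trivial x ≡ 0#
  trivial-≈0 {x} x≈0 with dec (x ≈ 0#)
  ... | yes _   = refl
  ... | no  x≉0 = contradiction x≈0 x≉0

  trivial-≉0 : ∀ {x} → x ≉ 0# → trivial x ≡ 1#
  trivial-≉0 {x} x≉0 with dec (x ≈ 0#)
  ... | yes x≈0 = contradiction x≈0 x≉0
  ... | no  _   = refl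

  trivial≤1 : ∀ x → trivial x ≤ 1#
  trivial≤1 x with dec (x ≈ 0#)
  ... | yes _ = 0≤ 1#
  ... | no  _ = ≤-refl {1#}

  trivialGauge : Gauge
  trivialGauge = record
    { ν    = λ _ → trivial
    ; mono = λ _ {x} {y} → mono x y
    ; homo = λ _ _ → homo
    ; null = λ _ {x} x≈0 → subst (_≈ 0#) (sym (trivial-≈0 {x} x≈0)) (≈-refl {0#})
    }
    where
    mono : ∀ x y → x ≤ y → trivial x ≤ trivial y
    mono x y x≤y with dec (x ≈ 0#)
    ... | yes _   = 0≤ (trivial y)
    ... | no  x≉0 = subst (1# ≤_) (sym (trivial-≉0 {y} (≉0-resp-≤ {x} {y} x≤y x≉0))) (≤-refl {1#})
    homo : ∀ x y → trivial (x · y) ≈ trivial x · trivial y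
    homo x y with dec (x ≈ 0#) | dec (y ≈ 0#)
    ... | yes x≈0 | d = subst (_≈ 0# · indicator d) (sym (trivial-≈0 {x · y} (·-zeroˡ {x} y x≈0)))
      (≈-sym {0# · indicator d} {0#} (·-zeroˡ {0#} (indicator d) (≈-refl {0#})))
    ... | no x≉0 | yes y≈0 = subst (_≈ 1# · 0#) (sym (trivial-≈0 {x · y} (·-zeroʳ x {y} y≈0)))
      (≈-sym {1# · 0#} {0#} (·-identityˡ 0#))
    ... | no x≉0 | no y≉0 = subst (_≈ 1# · 1#) (sym (trivial-≉0 {x · y} (·-≉0 x y x≉0 y≉0)))
      (≈-sym {1# · 1#} {1#} (·-identityˡ 1#))

  -- All nonzero coefficients tie under the trivial gauge, so its last peak is the degree.
  -- Uniqueness and additivity of degrees thereby become instances of the facts on peaks.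
  degree⇒peak : ∀ {p d} → HasDegree p d → Peak ℕ._>_ trivialGauge p d
  degree⇒peak {p} {d} (p_d≉0 , zeros) = record
    { nonzero   = subst (_≉ 0#) (sym one) 1≉0
    ; maximal   = λ i → subst (trivial (coeff p i) ≤_) (sym one) (trivial≤1 (coeff p i))
    ; separated = λ i d<i → subst₂ _<_ (sym (trivial-≈0 {coeff p i} (zeros i d<i))) (sym one)
                            (≈0<≉0 {0#} {1#} (≈-refl {0#}) 1≉0)
    }
    where
    one : trivial (coeff p d) ≡ 1#
    one = trivial-≉0 {coeff p d} p_d≉0

  peak⇒degree : ∀ {p d} → Peak ℕ._>_ trivialGauge p d → HasDegree p d
  peak⇒degree {p} {d} peak =
    (λ p_d≈0 → Peak.nonzero peak (subst (_≈ 0#) (sym (trivial-≈0 {coeff p d} p_d≈0)) (≈-refl {0#}))) , zeros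
    where
    zeros : ∀ i → d ℕ.< i → coeff p i ≈ 0#
    zeros i d<i with dec (coeff p i ≈ 0#)
    ... | yes p_i≈0 = p_i≈0
    ... | no  p_i≉0 = contradiction (trivial≤1 (coeff p d))
      (<⇒≰ (subst (_< trivial (coeff p d)) (trivial-≉0 {coeff p i} p_i≉0) (Peak.separated peak i d<i)))

  degree-unique : ∀ p {d e} → HasDegree p d → HasDegree p e → d ≡ e
  degree-unique p p-d p-e = peak-unique >-splitting trivialGauge {p} (degree⇒peak p-d) (degree⇒peak p-e)

  degree-⊡ : ∀ {p q r d e} → HasDegree q d → HasDegree r e → p ∈ q ⊡ r → HasDegree p (d ℕ.+ e)
  degree-⊡ {p} {q} {r} q-d r-e p∈ = peak⇒degree
    (peak-⊡ >-splitting trivialGauge {p} {q} {r} (degree⇒peak q-d) (degree⇒peak r-e) p∈)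

  zero-or-degree : ∀ p → (∀ i → coeff p i ≈ 0#) ⊎ ∃[ d ] HasDegree p d
  zero-or-degree p = let n , zeros = finite-support p in search n zeros
    where
    search : ∀ n → (∀ i → n ℕ.≤ i → coeff p i ≈ 0#) → (∀ i → coeff p i ≈ 0#) ⊎ ∃[ d ] HasDegree p d
    search zero    zeros = inj₁ λ i → zeros i ℕ.z≤n
    search (suc n) zeros with dec (coeff p n ≈ 0#)
    ... | no  p_n≉0 = inj₂ (n , p_n≉0 , zeros)
    ... | yes p_n≈0 = search n zeros′
      where
      zeros′ : ∀ i → n ℕ.≤ i → coeff p i ≈ 0#
      zeros′ i n≤i with ℕ.m≤n⇒m<n∨m≡n n≤i
      ... | inj₁ n<i  = zeros i n<i
      ... | inj₂ refl = p_n≈0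

  -- Associated polynomials

  scalar⇒∼ : ∀ {p q} a → a ≉ 0# → (∀ i → coeff p i ≈ a · coeff q i) → p ∼ q
  scalar⇒∼ {p} {q} a a≉0 p≈aq = a , a≉0 , λ i → ∈⊞-extend ℕ.z≤′n
    (λ { {suc k} _ → ·-zeroˡ {0#} (coeff q (i ∸ suc k)) (≈-refl {0#}) }) (lift (p≈aq i))

  degree-0-⊡ : ∀ {p q r} → HasDegree q 0 → p ∈ q ⊡ r → p ∼ r
  degree-0-⊡ {p} {q} {r} (q₀≉0 , zeros) p∈ = scalar⇒∼ {p} {r} (coeff q 0) q₀≉0 λ i →
    ∈⊞-single i {coeff p i} {j = 0} ℕ.z≤n
      (λ {k} _ k≢0 → ·-zeroˡ {coeff q k} (coeff r (i ∸ k)) (zeros k (ℕ.n≢0⇒n>0 k≢0))) (p∈ i)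

  ⊡-degree-0 : ∀ {p q r} → HasDegree r 0 → p ∈ q ⊡ r → p ∼ q
  ⊡-degree-0 {p} {q} {r} (r₀≉0 , zeros) p∈ = scalar⇒∼ {p} {q} (coeff r 0) r₀≉0 λ i →
    ≈-trans {coeff p i} {coeff q i · coeff r 0} {coeff r 0 · coeff q i}
      (subst (λ k → coeff p i ≈ coeff q i · coeff r k) (ℕ.n∸n≡0 i)
        (∈⊞-single i {coeff p i} {j = i} ℕ.≤-refl
          (λ {k} k≤i k≢i → ·-zeroʳ (coeff q k) {coeff r (i ∸ k)}
            (zeros (i ∸ k) (ℕ.m<n⇒0<n∸m (ℕ.≤∧≢⇒< k≤i k≢i)))) (p∈ i)))
      (·-comm (coeff q i) (coeff r 0))

  ∼⇒scalar : ∀ {p q} → p ∼ q → ∃[ a ] a ≉ 0# × (∀ i → coeff p i ≈ a · coeff q i)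
  ∼⇒scalar {p} {q} (a , a≉0 , p∈) = a , a≉0 , λ i → ∈⊞-single i {coeff p i} {j = 0} ℕ.z≤n
    (λ { {zero} _ 0≢0 → contradiction refl 0≢0
       ; {suc k} _ _ → ·-zeroˡ {0#} (coeff q (i ∸ suc k)) (≈-refl {0#}) }) (p∈ i)

  ∼-refl : ∀ {p} → p ∼ p
  ∼-refl {p} = scalar⇒∼ {p} {p} 1# 1≉0 λ i → ≈-sym {1# · coeff p i} {coeff p i} (·-identityˡ (coeff p i))

  ∼-sym : ∀ {p q} → p ∼ q → q ∼ p
  ∼-sym {p} {q} p∼q =
    let a , a≉0 , p≈aq = ∼⇒scalar {p} {q} p∼q
        b , ba≈1 = divide 1# {a} a≉0
        b≉0 = λ b≈0 → 1≉0 (≈-trans {1#} {b · a} {0#} (≈-sym {b · a} {1#} ba≈1) (·-zeroˡ {b} a b≈0))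
    in scalar⇒∼ {q} {p} b b≉0 λ i → begin-equality
      coeff q i            ≈⟨ ≈-sym {1# · coeff q i} {coeff q i} (·-identityˡ (coeff q i)) ⟩
      1# · coeff q i       ≈⟨ ·-cong {1#} {b · a} {coeff q i} {coeff q i}
                                     (≈-sym {b · a} {1#} ba≈1) (≈-refl {coeff q i}) ⟩
      b · a · coeff q i    ≈⟨ ·-assoc b a (coeff q i) ⟩
      b · (a · coeff q i)  ≈⟨ ·-congˡ b {a · coeff q i} {coeff p i} (≈-sym {coeff p i} {a · coeff q i} (p≈aq i)) ⟩
      b · coeff p i        ∎
    where open ≤-Reasoning

  ∼-trans : ∀ {p q r} → p ∼ q → q ∼ r → p ∼ r
  ∼-trans {p} {q} {r} p∼q q∼r =
    let a , a≉0 , p≈aq = ∼⇒scalar {p} {q} p∼q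
        b , b≉0 , q≈br = ∼⇒scalar {q} {r} q∼r
    in scalar⇒∼ {p} {r} (a · b) (·-≉0 a b a≉0 b≉0) λ i → begin-equality
      coeff p i            ≈⟨ p≈aq i ⟩
      a · coeff q i        ≈⟨ ·-congˡ a {coeff q i} {b · coeff r i} (q≈br i) ⟩
      a · (b · coeff r i)  ≈⟨ ≈-sym {a · b · coeff r i} {a · (b · coeff r i)} (·-assoc a b (coeff r i)) ⟩
      a · b · coeff r i    ∎
    where open ≤-Reasoning

  degree-const : ∀ {a} → a ≉ 0# → HasDegree (const a) 0
  degree-const a≉0 = a≉0 , λ { (suc _) _ → ≈-refl {0#} }

  ∼-degree : ∀ {p q d} → p ∼ q → HasDegree q d → HasDegree p d
  ∼-degree {p} {q} (a , a≉0 , p∈) q-d = degree-⊡ {p} {const a} {q} (degree-const {a} a≉0) q-d p∈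

  -- Irreducible polynomials

  -- Degrees add, so one of two factors has degree 0 and is a nonzero constant. Zero factors, which
  -- have no degree, would make the coefficient of T vanish.
  degree-1⇒irreducible : ∀ p → HasDegree p 1 → Irreducible p
  degree-1⇒irreducible p p-1@(p₁≉0 , _) = (1 , ℕ.≤-refl , p-1) , factors
    where
    factors : ∀ q r → p ∈ q ⊡ r → p ∼ q ⊎ p ∼ r
    factors q r p∈ with zero-or-degree q | zero-or-degree r
    ... | inj₁ q≈0 | _ = let i , j , _ , p₁≤ = ⊡⇒≤ p q r p∈ 1 in
      contradiction (≤0⇒≈0 {coeff p 1} (≤-trans {coeff p 1} {coeff q i · coeff r j} {0#} p₁≤
        (proj₁ (·-zeroˡ {coeff q i} (coeff r j) (q≈0 i))))) p₁≉0
    ... | inj₂ _ | inj₁ r≈0 = let i , j , _ , p₁≤ = ⊡⇒≤ p q r p∈ 1 in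
      contradiction (≤0⇒≈0 {coeff p 1} (≤-trans {coeff p 1} {coeff q i · coeff r j} {0#} p₁≤
        (proj₁ (·-zeroʳ (coeff q i) {coeff r j} (r≈0 j))))) p₁≉0
    ... | inj₂ (d , q-d) | inj₂ (e , r-e) =
      by-degree d e q-d r-e (degree-unique p p-1 (degree-⊡ {p} {q} {r} q-d r-e p∈))
      where
      by-degree : ∀ d e → HasDegree q d → HasDegree r e → 1 ≡ d ℕ.+ e → p ∼ q ⊎ p ∼ r
      by-degree 0             _ q-0 r-e _  = inj₂ (degree-0-⊡ {p} {q} {r} q-0 p∈)
      by-degree 1             0 q-1 r-0 _  = inj₁ (⊡-degree-0 {p} {q} {r} r-0 p∈)

  -- Splitting off a linear factor

  linear : ℝ≥0 → ℝ≥0 → Poly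
  linear v y = record
    { coeff          = λ { 0 → v ; 1 → y ; (suc (suc _)) → 0# }
    ; finite-support = 2 , λ { (suc (suc _)) _ → ≈-refl {0#} ; 1 (ℕ.s≤s ()) }
    }

  degree-linear : ∀ v {y} → y ≉ 0# → HasDegree (linear v y) 1
  degree-linear v y≉0 = y≉0 , λ { (suc (suc _)) _ → ≈-refl {0#} ; 1 (ℕ.s≤s ()) }

  linear-⊡ : ∀ {p r} v y → coeff p 0 ≈ v · coeff r 0 →
             (∀ i → coeff p (suc i) ∈ v · coeff r (suc i) ⊞ y · coeff r i) → p ∈ linear v y ⊡ r
  linear-⊡ {p} {r} v y p₀≈ p∈ zero    = lift p₀≈
  linear-⊡ {p} {r} v y p₀≈ p∈ (suc i) = ∈⊞-extend {1} {suc i} {coeff p (suc i)} (ℕ.s≤′s ℕ.z≤′n)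
    (λ { {suc (suc k)} _ → ·-zeroˡ {0#} (coeff r (i ∸ suc k)) (≈-refl {0#}) ; {1} (ℕ.s≤s ()) })
    (v · coeff r (suc i) , lift (≈-refl {v · coeff r (suc i)}) , p∈ i)

  module _ {p : Poly} {n : ℕ} (p-deg : HasDegree p (suc n)) where

    -- The Horner equation needs a nonzero constant term. Without one, T itself splits off and the
    -- cofactor is `p` shifted down.
    reduce-by-T : coeff p 0 ≈ 0# → ∃[ q ] ∃[ r ] HasDegree q 1 × HasDegree r n × p ∈ q ⊡ r
    reduce-by-T p₀≈0 = linear 0# 1# , r , degree-linear 0# 1≉0 , (proj₁ p-deg , zeros) ,
      linear-⊡ {p} {r} 0# 1#
        (≈-trans {coeff p 0} {0#} {0# · coeff r 0} p₀≈0 (≈-sym {0# · coeff r 0} {0#} (0·≈0 0)))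
        λ i → ∈0⊞ {coeff p (suc i)} {0# · coeff r (suc i)} {1# · coeff r i} (0·≈0 (suc i))
                (≈-sym {1# · coeff p (suc i)} {coeff p (suc i)} (·-identityˡ (coeff p (suc i))))
      where
      zeros : ∀ i → n ℕ.< i → coeff p (suc i) ≈ 0#
      zeros i n<i = proj₂ p-deg (suc i) (ℕ.s≤s n<i)
      r : Poly
      r = record { coeff = λ i → coeff p (suc i) ; finite-support = suc n , zeros }
      0·≈0 : ∀ i → 0# · coeff r i ≈ 0#
      0·≈0 i = ·-zeroˡ {0#} (coeff r i) (≈-refl {0#})

    reduce-by-root : coeff p 0 ≉ 0# → ∃[ q ] ∃[ r ] HasDegree q 1 × HasDegree r n × p ∈ q ⊡ r
    reduce-by-root p₀≉0 = linear 1# y , r , degree-linear 1# {y} y≉0 , (rₙ≉0 , λ i n<i → r≈0 n<i) ,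
      linear-⊡ {p} {r} 1# y p₀≈ p∈
      where
      d = coeff p (suc n)
      -- At index n + 1 the cofactor contributes only y rₙ, which must therefore equal the leading
      -- coefficient.
      root = horner-solution (coeff p) n d p₀≉0 (proj₁ p-deg)
      y = proj₁ root
      h : ℕ → ℝ≥0
      h = horner (coeff p) y
      yhₙ≈d : y · h n ≈ d
      yhₙ≈d = proj₂ root
      yhₙ≉0 : y · h n ≉ 0#
      yhₙ≉0 = ≉0-resp-≤ {d} {y · h n} (proj₂ yhₙ≈d) (proj₁ p-deg)
      y≉0 : y ≉ 0#
      y≉0 y≈0 = yhₙ≉0 (·-zeroˡ {y} (h n) y≈0)

      -- The Horner values stay nonzero beyond `n`, as both `y` and the constant term are nonzero,
      -- so the cofactor has to be cut off by hand.
      truncate : ∀ i → Dec (i ℕ.≤ n) → ℝ≥0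
      truncate i (yes _) = h i
      truncate i (no  _) = 0#

      rᵢ : ℕ → ℝ≥0
      rᵢ i = truncate i (i ℕ.≤? n)

      r≡h : ∀ {i} → i ℕ.≤ n → rᵢ i ≡ h i
      r≡h {i} i≤n with i ℕ.≤? n
      ... | yes _   = refl
      ... | no  i≰n = contradiction i≤n i≰n

      r≈0 : ∀ {i} → n ℕ.< i → rᵢ i ≈ 0#
      r≈0 {i} n<i with i ℕ.≤? n
      ... | yes i≤n = contradiction i≤n (ℕ.<⇒≱ n<i)
      ... | no  _   = ≈-refl {0#}

      r : Poly
      r = record { coeff = rᵢ ; finite-support = suc n , λ i n<i → r≈0 n<i }

      rₙ≉0 : rᵢ n ≉ 0#
      rₙ≉0 rₙ≈0 = yhₙ≉0 (·-zeroʳ y {h n} (subst (_≈ 0#) (r≡h ℕ.≤-refl) rₙ≈0))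

      h≈1·r : ∀ {i} → i ℕ.≤ n → h i ≈ 1# · rᵢ i
      h≈1·r {i} i≤n = subst (λ x → h i ≈ 1# · x) (sym (r≡h i≤n))
        (≈-sym {1# · h i} {h i} (·-identityˡ (h i)))

      y·h≈y·r : ∀ {i} → i ℕ.≤ n → y · h i ≈ y · rᵢ i
      y·h≈y·r {i} i≤n = subst (λ x → y · h i ≈ y · x) (sym (r≡h i≤n)) (≈-refl {y · h i})

      1·r≈0 : ∀ {i} → n ℕ.< i → 1# · rᵢ i ≈ 0#
      1·r≈0 {i} n<i = ·-zeroʳ 1# {rᵢ i} (r≈0 n<i)

      p₀≈ : coeff p 0 ≈ 1# · rᵢ 0
      p₀≈ = h≈1·r ℕ.z≤n

      p∈ : ∀ i → coeff p (suc i) ∈ 1# · rᵢ (suc i) ⊞ y · rᵢ i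
      -- Below `n` the recursion applies, at `n` the equation defining `y`, and beyond it everything
      -- vanishes.
      p∈ i with ℕ.<-cmp i n
      ... | tri< i<n _ _ = ⊞-resp-≈ {coeff p (suc i)} {h (suc i)} {1# · rᵢ (suc i)} {y · h i} {y · rᵢ i}
              (h≈1·r i<n) (y·h≈y·r (ℕ.<⇒≤ i<n)) (∈⊔⊞ (coeff p (suc i)) (y · h i))
      ... | tri≈ _ refl _ = ∈0⊞ {d} {1# · rᵢ (suc n)} {y · rᵢ n} (1·r≈0 ℕ.≤-refl)
              (≈-trans {d} {y · h n} {y · rᵢ n} (≈-sym {y · h n} {d} yhₙ≈d) (y·h≈y·r ℕ.≤-refl))
      ... | tri> _ _ n<i = ∈0⊞ {coeff p (suc i)} {1# · rᵢ (suc i)} {y · rᵢ i} (1·r≈0 (ℕ.m<n⇒m<1+n n<i))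
              (≈-trans {coeff p (suc i)} {0#} {y · rᵢ i} (proj₂ p-deg (suc i) (ℕ.s≤s n<i))
                (≈-sym {y · rᵢ i} {0#} (·-zeroʳ y {rᵢ i} (r≈0 n<i))))

    linear-factor : ∃[ q ] ∃[ r ] HasDegree q 1 × HasDegree r n × p ∈ q ⊡ r
    linear-factor with dec (coeff p 0 ≈ 0#)
    ... | yes p₀≈0 = reduce-by-T p₀≈0
    ... | no  p₀≉0 = reduce-by-root p₀≉0

  -- In degree n + 2 a linear factor splits off with a cofactor of degree n + 1. Associates share
  -- their degree, so `p` can only be associated to the linear factor, and then has degree 1 after
  -- all.
  irreducible⇒degree-1 : ∀ p → Irreducible p → HasDegree p 1
  irreducible⇒degree-1 p ((1 , _ , p-1) , _) = p-1
  irreducible⇒degree-1 p ((suc (suc n) , _ , p-deg) , factors) =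
    let q , r , q-deg , r-deg , p∈ = linear-factor {p} {suc n} p-deg
    in contra q r q-deg r-deg (factors q r p∈)
    where
    contra : ∀ q r → HasDegree q 1 → HasDegree r (suc n) → p ∼ q ⊎ p ∼ r → HasDegree p 1
    contra q r q-deg r-deg (inj₁ p∼q) = ∼-degree {p} {q} p∼q q-deg
    contra q r q-deg r-deg (inj₂ p∼r) =
      contradiction (sym (degree-unique p p-deg (∼-degree {p} {r} p∼r r-deg))) (ℕ.<⇒≢ ℕ.≤-refl)

  -- Counting associates

  associates : Poly → Poly → ℕ
  associates t q = bit (em {q ∼ t})

  module _ (t : Poly) (t-linear : HasDegree t 1) where

    private
      t₁≉0 = proj₁ t-linear

    -- As -a = a, the root of t₀ + t₁T is t₀ / t₁, the point at which its two monomials tie. Among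
    -- linear polynomials it determines the class up to `_∼_`.
    root : ℝ≥0
    root = proj₁ (divide (coeff t 0) {coeff t 1} t₁≉0)

    private
      x = root
      x·t₁≈t₀ : x · coeff t 1 ≈ coeff t 0
      x·t₁≈t₀ = proj₂ (divide (coeff t 0) {coeff t 1} t₁≉0)

    ∼⇒root : ∀ {q} → q ∼ t → coeff q 0 ≈ x · coeff q 1
    ∼⇒root {q} q∼t = let a , _ , q≈at = ∼⇒scalar {q} {t} q∼t in begin-equality
      coeff q 0            ≈⟨ q≈at 0 ⟩
      a · coeff t 0        ≈⟨ ·-congˡ a {coeff t 0} {x · coeff t 1} (≈-sym {x · coeff t 1} {coeff t 0} x·t₁≈t₀) ⟩
      a · (x · coeff t 1)  ≈⟨ x∙yz≈y∙xz a x (coeff t 1) ⟩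
      x · (a · coeff t 1)  ≈⟨ ·-congˡ x {a · coeff t 1} {coeff q 1} (≈-sym {coeff q 1} {a · coeff t 1} (q≈at 1)) ⟩
      x · coeff q 1        ∎
      where open ≤-Reasoning

    root⇒∼ : ∀ {q} → HasDegree q 1 → coeff q 0 ≈ x · coeff q 1 → q ∼ t
    root⇒∼ {q} (q₁≉0 , q-zeros) q₀≈xq₁ = scalar⇒∼ {q} {t} a a≉0 λ
      { 0 → begin-equality
          coeff q 0            ≈⟨ q₀≈xq₁ ⟩
          x · coeff q 1        ≈⟨ ·-congˡ x {coeff q 1} {a · coeff t 1} (≈-sym {a · coeff t 1} {coeff q 1} a·t₁≈q₁) ⟩
          x · (a · coeff t 1)  ≈⟨ x∙yz≈y∙xz x a (coeff t 1) ⟩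
          a · (x · coeff t 1)  ≈⟨ ·-congˡ a {x · coeff t 1} {coeff t 0} x·t₁≈t₀ ⟩
          a · coeff t 0        ∎
      ; 1 → ≈-sym {a · coeff t 1} {coeff q 1} a·t₁≈q₁
      ; i@(suc (suc _)) → ≈-trans {coeff q i} {0#} {a · coeff t i} (q-zeros i (ℕ.s≤s (ℕ.s≤s ℕ.z≤n)))
          (≈-sym {a · coeff t i} {0#} (·-zeroʳ a {coeff t i} (proj₂ t-linear i (ℕ.s≤s (ℕ.s≤s ℕ.z≤n)))))
      }
      where
      open ≤-Reasoning
      a = proj₁ (divide (coeff q 1) {coeff t 1} t₁≉0)
      a·t₁≈q₁ : a · coeff t 1 ≈ coeff q 1
      a·t₁≈q₁ = proj₂ (divide (coeff q 1) {coeff t 1} t₁≉0)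
      a≉0 : a ≉ 0#
      a≉0 a≈0 = q₁≉0 (≈-trans {coeff q 1} {a · coeff t 1} {0#} (≈-sym {a · coeff t 1} {coeff q 1} a·t₁≈q₁)
                       (·-zeroˡ {a} (coeff t 1) a≈0))

    -- For t ∼ T the peak index is the order of vanishing.
    order-peak : root ≈ 0# → ∀ {q} → HasDegree q 1 → Peak ℕ._<_ trivialGauge q (associates t q)
    order-peak x≈0 {q} q-linear@(q₁≉0 , _) with em {q ∼ t}
    ... | yes q∼t = linear-peak₁ <-splitting trivialGauge {q} q-linear
            (subst (_≉ 0#) (sym one) 1≉0) (subst₂ _≤_ (sym zero₀) (sym one) (0≤ 1#))
            (λ _ → subst₂ _<_ (sym zero₀) (sym one) (≈0<≉0 {0#} {1#} (≈-refl {0#}) 1≉0))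
      where
      one : trivial (coeff q 1) ≡ 1#
      one = trivial-≉0 {coeff q 1} q₁≉0
      zero₀ : trivial (coeff q 0) ≡ 0#
      zero₀ = trivial-≈0 {coeff q 0}
        (≈-trans {coeff q 0} {x · coeff q 1} {0#} (∼⇒root {q} q∼t) (·-zeroˡ {x} (coeff q 1) x≈0))
    ... | no  q≁t = linear-peak₀ <-splitting trivialGauge {q} q-linear
            (subst (_≉ 0#) (sym one) 1≉0)
            (subst (trivial (coeff q 1) ≤_) (sym one) (trivial≤1 (coeff q 1))) (λ ())
      where
      one : trivial (coeff q 0) ≡ 1#
      one = trivial-≉0 {coeff q 0} λ q₀≈0 → q≁t (root⇒∼ {q} q-linear
        (≈-trans {coeff q 0} {0#} {x · coeff q 1} q₀≈0 (≈-sym {x · coeff q 1} {0#} (·-zeroˡ {x} (coeff q 1) x≈0))))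

    -- The two monomials of `q` tie at the root of `t` exactly if `q ∼ t`; then the first index is 0
    -- and the last is 1, and otherwise they coincide. A nonzero root keeps the linear monomial from
    -- vanishing, so that a tie is a peak.
    point-peaks : root ≉ 0# → ∀ {q} → HasDegree q 1 →
                  ∃[ l ] Peak ℕ._<_ (pointGauge root) q l ×
                         Peak ℕ._>_ (pointGauge root) q (l ℕ.+ associates t q)
    point-peaks x≉0 {q} q-linear@(q₁≉0 , _) = compare (≤-or-> V₀ V₁) (≤-or-> V₁ V₀)
      where
      open ≤-Reasoning
      G = pointGauge x
      V₀ V₁ : ℝ≥0
      -- `0 ×ᵐ x` reduces to `1#` and `1 ×ᵐ x` to `x · 1#`, so these are the gauged coefficients.
      V₀ = coeff q 0 · 1#
      V₁ = coeff q 1 · (x · 1#)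
      V₀≈ : V₀ ≈ coeff q 0
      V₀≈ = ·-identityʳ (coeff q 0)
      V₁≈ : V₁ ≈ x · coeff q 1
      V₁≈ = begin-equality
        coeff q 1 · (x · 1#)  ≈⟨ x∙yz≈y∙xz (coeff q 1) x 1# ⟩
        x · (coeff q 1 · 1#)  ≈⟨ ·-congˡ x {coeff q 1 · 1#} {coeff q 1} (·-identityʳ (coeff q 1)) ⟩
        x · coeff q 1         ∎
      V₁≉0 : V₁ ≉ 0#
      V₁≉0 = ≉0-resp-≤ {x · coeff q 1} {V₁} (proj₂ V₁≈) (·-≉0 x (coeff q 1) x≉0 q₁≉0)
      ∼⇒V₀≈V₁ : q ∼ t → V₀ ≈ V₁
      ∼⇒V₀≈V₁ q∼t = begin-equality
        V₀             ≈⟨ V₀≈ ⟩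
        coeff q 0      ≈⟨ ∼⇒root {q} q∼t ⟩
        x · coeff q 1  ≈⟨ ≈-sym {V₁} {x · coeff q 1} V₁≈ ⟩
        V₁             ∎
      V₀≈V₁⇒∼ : V₀ ≈ V₁ → q ∼ t
      V₀≈V₁⇒∼ V₀≈V₁ = root⇒∼ {q} q-linear (begin-equality
        coeff q 0      ≈⟨ ≈-sym {V₀} {coeff q 0} V₀≈ ⟩
        V₀             ≈⟨ V₀≈V₁ ⟩
        V₁             ≈⟨ V₁≈ ⟩
        x · coeff q 1  ∎)

      Goal : Set
      Goal = ∃[ l ] Peak ℕ._<_ G q l × Peak ℕ._>_ G q (l ℕ.+ associates t q)

      goal : ∀ l k → associates t q ≡ k → Peak ℕ._<_ G q l → Peak ℕ._>_ G q (l ℕ.+ k) → Goal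
      goal l k refl first last = l , first , last

      compare : V₀ ≤ V₁ ⊎ V₁ < V₀ → V₁ ≤ V₀ ⊎ V₀ < V₁ → Goal
      compare (inj₂ V₁<V₀) _ = goal 0 0 (bit-no em λ q∼t → <⇒≰ V₁<V₀ (proj₁ (∼⇒V₀≈V₁ q∼t)))
        (linear-peak₀ <-splitting G {q} q-linear V₀≉0 (<⇒≤ {V₁} {V₀} V₁<V₀) (λ ()))
        (linear-peak₀ >-splitting G {q} q-linear V₀≉0 (<⇒≤ {V₁} {V₀} V₁<V₀) (λ _ → V₁<V₀))
        where V₀≉0 = <⇒≉0 {V₁} {V₀} V₁<V₀
      compare _ (inj₂ V₀<V₁) = goal 1 0 (bit-no em λ q∼t → <⇒≰ V₀<V₁ (proj₂ (∼⇒V₀≈V₁ q∼t)))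
        (linear-peak₁ <-splitting G {q} q-linear V₁≉0 (<⇒≤ {V₀} {V₁} V₀<V₁) (λ _ → V₀<V₁))
        (linear-peak₁ >-splitting G {q} q-linear V₁≉0 (<⇒≤ {V₀} {V₁} V₀<V₁) (λ ()))
      compare (inj₁ V₀≤V₁) (inj₁ V₁≤V₀) = goal 0 1 (bit-yes em (V₀≈V₁⇒∼ (V₀≤V₁ , V₁≤V₀)))
        (linear-peak₀ <-splitting G {q} q-linear (≉0-resp-≤ {V₁} {V₀} V₁≤V₀ V₁≉0) V₁≤V₀ (λ ()))
        (linear-peak₁ >-splitting G {q} q-linear V₁≉0 V₀≤V₁ (λ ()))

    count-unique : ∀ {n m p} (q : Fin (suc n) → Poly) (q′ : Fin (suc m) → Poly) →
                   (∀ i → HasDegree (q i) 1) → (∀ j → HasDegree (q′ j) 1) → p ∈⊡ q → p ∈⊡ q′ →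
                   sum (associates t ∘ q) ≡ sum (associates t ∘ q′)
    count-unique {n} {m} {p} q q′ q-linear q′-linear p∈ p∈′ with dec (root ≈ 0#)
    ... | yes x≈0 = peak-unique <-splitting trivialGauge {p}
            (peak-⊡* <-splitting trivialGauge {n} {p} q  (associates t ∘ q)
              (λ i → order-peak x≈0 (q-linear i)) p∈)
            (peak-⊡* <-splitting trivialGauge {m} {p} q′ (associates t ∘ q′)
              (λ i → order-peak x≈0 (q′-linear i)) p∈′)
    -- The product fixes both its first index, `sum l`, and its last, which exceeds it by the number
    -- of associates; cancelling leaves the count.
    ... | no  x≉0 = ℕ.+-cancelˡ-≡ (sum l) _ _ (begin
            sum l ℕ.+ sum (associates t ∘ q)         ≡⟨ sym (∑-distrib-+ l (associates t ∘ q)) ⟩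
            sum (λ i → l i ℕ.+ associates t (q i))    ≡⟨ last-≡ ⟩
            sum (λ j → l′ j ℕ.+ associates t (q′ j))  ≡⟨ ∑-distrib-+ l′ (associates t ∘ q′) ⟩
            sum l′ ℕ.+ sum (associates t ∘ q′)       ≡⟨ cong (ℕ._+ sum (associates t ∘ q′)) (sym first-≡) ⟩
            sum l ℕ.+ sum (associates t ∘ q′)        ∎)
      where
      open ≡-Reasoning
      G = pointGauge root
      peaks = λ i → point-peaks x≉0 (q-linear i)
      peaks′ = λ j → point-peaks x≉0 (q′-linear j)
      l : Fin (suc n) → ℕ
      l i = proj₁ (peaks i)
      l′ : Fin (suc m) → ℕ
      l′ j = proj₁ (peaks′ j)
      first-≡ : sum l ≡ sum l′
      first-≡ = peak-unique <-splitting G {p}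
        (peak-⊡* <-splitting G {n} {p} q  l  (proj₁ ∘ proj₂ ∘ peaks)  p∈)
        (peak-⊡* <-splitting G {m} {p} q′ l′ (proj₁ ∘ proj₂ ∘ peaks′) p∈′)
      last-≡ : sum (λ i → l i ℕ.+ associates t (q i)) ≡ sum (λ j → l′ j ℕ.+ associates t (q′ j))
      last-≡ = peak-unique >-splitting G {p}
        (peak-⊡* >-splitting G {n} {p} q  _ (proj₂ ∘ proj₂ ∘ peaks)  p∈)
        (peak-⊡* >-splitting G {m} {p} q′ _ (proj₂ ∘ proj₂ ∘ peaks′) p∈′)

  -- Irreducible factors are linear, and `count-unique` gives every class of linear polynomials
  -- equally many members in both families, so `match` pairs them. Factors carry their degree proof
  -- since only linear `t` are counted.
  uniqueFactorization : UniqueFactorization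
  uniqueFactorization p q q′ q-irr q′-irr p∈ p∈′ =
    let 1+n≡1+m , σ , related = match e e-refl (λ {s} {t} → e-resp {s} {t}) f f′
          (λ (t , t-linear) → count-unique t t-linear {p = p} q q′ (proj₂ ∘ f) (proj₂ ∘ f′) p∈ p∈′)
    -- A nonzero count says that the factor of the second family is associated to that of the first,
    -- hence the reversal.
    in 1+n≡1+m , σ , λ i → ∼-sym {q′ (σ ⟨$⟩ʳ i)} {q i} (bit≢0 em (related i))
    where
    Linear : Set₁
    Linear = Σ[ q ∈ Poly ] HasDegree q 1
    f = λ i → q i , irreducible⇒degree-1 (q i) (q-irr i)
    f′ = λ j → q′ j , irreducible⇒degree-1 (q′ j) (q′-irr j)
    e : Linear → Linear → ℕ
    e (t , _) (r , _) = associates t r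
    e-refl : ∀ s → e s s ≢ 0
    e-refl (s , _) e≡0 = contradiction (trans (sym (bit-yes em (∼-refl {s}))) e≡0) λ ()
    e-resp : ∀ {s t} → e s t ≢ 0 → ∀ r → e r s ≡ e r t
    e-resp {s , _} {t , _} e≢0 (r , _) with em {s ∼ r}
    ... | yes s∼r = sym (bit-yes em (∼-trans {t} {s} {r} t∼s s∼r))
      where t∼s = bit≢0 (em {t ∼ s}) e≢0
    ... | no  s≁r = sym (bit-no em λ t∼r → s≁r (∼-trans {s} {t} {r} (∼-sym {t} {s} t∼s) t∼r))
      where t∼s = bit≢0 (em {t ∼ s}) e≢0

mainTheorem5 : ExcludedMiddle (lsuc 0ℓ) →
    (∀ (p : Poly) → Irreducible p ⇔ HasDegree p 1) × UniqueFactorization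
mainTheorem5 em =
  (λ p → mk⇔ (irreducible⇒degree-1 p) (degree-1⇒irreducible p)) , uniqueFactorization
  where
  open Classical em
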